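{- Let $U$ be a set of variables, $k,\ell\ge1$, $\vec r=(r_1,\dots,r_k)\in\mathbb{Z}_{\ge1}^k$, $\vec s=(s_1,\dots,s_\ell)\in\mathbb{Z}_{\ge1}^\ell$, $\vec u\in U^k$, $\vec v\in U^\ell$. Then in the field $\mathbb{Z}(U)$ of rational functions, $$f\begin{pmatrix}\vec r\\ \vec u\end{pmatrix}\, f\begin{pmatrix}\vec s\\ \vec v\end{pmatrix}=\sum_{(\varphi,\psi)\in I_{k,\ell}}\ \sum_{\substack{\vec t\in\mathbb{Z}_{\ge1}^{k+\ell}\\ |\vec t|=|\vec r|+|\vec s|}}\Big(\prod_{i=1}^{k+\ell}c^{\vec t,(\varphi,\psi)}_{\vec r,\vec s}(i)\Big)\, f\begin{pmatrix}\vec t\\ \vec u\,ш_{(\varphi,\psi)}\vec v\end{pmatrix}.$$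
   Context: For positive integers $s_1,\dots,s_k$ and variables $u_1,\dots,u_k$, $f\begin{pmatrix} s_1,\dots,s_k\\ u_1,\dots,u_k\end{pmatrix}=\frac{1}{(u_1+\cdots+u_k)^{s_1}(u_2+\cdots+u_k)^{s_2}\cdots u_k^{s_k}}$. For $\vec t\in\mathbb{Z}^n$, $|\vec t|=t_1+\cdots+t_n$. $I_{k,\ell}$ is the set of pairs $(\varphi,\psi)$ of order-preserving injective maps $\varphi:\{1,\dots,k\}\to\{1,\dots,k+\ell\}$, $\psi:\{1,\dots,\ell\}\to\{1,\dots,k+\ell\}$ with $\mathrm{im}\varphi\cup\mathrm{im}\psi=\{1,\dots,k+\ell\}$ (so the images are disjoint). The vector $\vec u\,ш_{(\varphi,\psi)}\vec v\in U^{k+\ell}$ has $i$-th component $u_j$ if $i=\varphi(j)$ and $v_j$ if $i=\psi(j)$. Set $h_i=r_j$ if $i=\varphi(j)$ and $h_i=s_j$ if $i=\psi(j)$. Put $R_i=r_1+\cdots+r_i$, $S_i=s_1+\cdots+s_i$, $T_i=t_1+\cdots+t_i$, with $R_0=S_0=0$. Define $$c^{\vec t,(\varphi,\psi)}_{\vec r,\vec s}(i)=\begin{cases}\binom{t_i-1}{h_i-1}& \text{if } i=1,\text{ or } i-1,i\in\mathrm{im}\varphi,\text{ or } i-1,i\in\mathrm{im}\psi,\\[2pt] \binom{t_i-1}{T_i-R_{|\varphi^{ -1}(\{1,\dots,i\})|}-S_{|\psi^{ -1}(\{1,\dots,i\})|}} & \text{otherwise,}\end{cases}$$ where $\binom{n}{m}=0$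 if $m<0$ or $m>n$. -}

module Defs where

open import Algebra.Bundles using (AbelianGroup; CommutativeRing)
import Algebra.Properties.Group as GroupProperties
import Algebra.Properties.Ring as RingProperties
import Algebra.Solver.Ring.NaturalCoefficients.Default as SemiringSolver
open import Data.Empty using (⊥-elim)
open import Data.Fin as Fin using (Fin; zero; suc; toℕ; _↑ˡ_; _↑ʳ_; splitAt)
import Data.Fin.Properties as Fin
open import Data.Integer as ℤ using (ℤ; +_; -[1+_]; ∣_∣; _⊖_)
import Data.Integer.Properties as ℤ
open import Data.List as List using (List; []; _∷_)
open import Data.Maybe as Maybe using (Maybe)
open import Data.Nat as ℕ using (ℕ; zero; suc; _≤_; _<_; _⊔_)
open import Data.Nat.Combinatorics using (_C_)
import Data.Nat.ListAction as ListAction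
import Data.Nat.Properties as ℕ
open import Data.Product using (Σ; ∃; ∃-syntax; _×_; _,_; proj₁; proj₂)
open import Data.Sum as Sum using (_⊎_; inj₁; inj₂; [_,_]′)
open import Data.Vec as Vec using (Vec; []; _∷_; lookup)
open import Function using (_∘_; id)
open import Level using (Level)
open import Relation.Binary.PropositionalEquality
  using (_≡_; refl; sym; trans; cong; cong₂; subst; _≗_)
open import Relation.Nullary
  using (¬_; Dec; yes; no; contradiction; does; map′; _×-dec_; _⊎-dec_; _→-dec_; dec⇒maybe)
open import Data.Bool using (if_then_else_)

private
  variable
    a b : Level
    U : Set a
    V : Set b

------------------------------------------------------------------------
-- The polynomial ring ℤ[U], presented as the free commutative
-- ℤ-algebra on U: ring expressions modulo the congruence _≋_ generated
-- by the commutative ring axioms and con being a ring homomorphism.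

infixl 6 _⊕_
infixl 7 _⊗_
infix  8 ⊝_
infix  4 _≋_

data Poly (U : Set a) : Set a where
  con : ℤ → Poly U
  var : U → Poly U
  _⊕_ : Poly U → Poly U → Poly U
  _⊗_ : Poly U → Poly U → Poly U
  ⊝_  : Poly U → Poly U

0ₚ 1ₚ : Poly U
0ₚ = con (+ 0)
1ₚ = con (+ 1)

data _≋_ {U : Set a} : Poly U → Poly U → Set a where
  ≋-refl  : ∀ {p} → p ≋ p
  ≋-sym   : ∀ {p q} → p ≋ q → q ≋ p
  ≋-trans : ∀ {p q r} → p ≋ q → q ≋ r → p ≋ r
  ⊕-cong  : ∀ {p p′ q q′} → p ≋ p′ → q ≋ q′ → p ⊕ q ≋ p′ ⊕ q′
  ⊗-cong  : ∀ {p p′ q q′} → p ≋ p′ → q ≋ q′ → p ⊗ q ≋ p′ ⊗ q′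
  ⊝-cong  : ∀ {p p′} → p ≋ p′ → ⊝ p ≋ ⊝ p′
  ⊕-assoc     : ∀ p q r → (p ⊕ q) ⊕ r ≋ p ⊕ (q ⊕ r)
  ⊕-comm      : ∀ p q → p ⊕ q ≋ q ⊕ p
  ⊕-identityˡ : ∀ p → 0ₚ ⊕ p ≋ p
  ⊝-inverseˡ  : ∀ p → (⊝ p) ⊕ p ≋ 0ₚ
  ⊗-assoc     : ∀ p q r → (p ⊗ q) ⊗ r ≋ p ⊗ (q ⊗ r)
  ⊗-comm      : ∀ p q → p ⊗ q ≋ q ⊗ p
  ⊗-identityˡ : ∀ p → 1ₚ ⊗ p ≋ p
  ⊗-distribʳ  : ∀ p q r → (q ⊕ r) ⊗ p ≋ (q ⊗ p) ⊕ (r ⊗ p)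
  con-⊕ : ∀ m n → con (m ℤ.+ n) ≋ con m ⊕ con n
  con-⊗ : ∀ m n → con (m ℤ.* n) ≋ con m ⊗ con n

polyRing : Set a → CommutativeRing a a
polyRing U = record
  { Carrier = Poly U ; _≈_ = _≋_
  ; _+_ = _⊕_ ; _*_ = _⊗_ ; -_ = ⊝_ ; 0# = 0ₚ ; 1# = 1ₚ
  ; isCommutativeRing = record
    { isRing = record
      { +-isAbelianGroup = record
        { isGroup = record
          { isMonoid = record
            { isSemigroup = record
              { isMagma = record
                { isEquivalence = record
                  { refl = ≋-refl ; sym = ≋-sym ; trans = ≋-trans }
                ; ∙-cong = ⊕-cong }
              ; assoc = ⊕-assoc }
            ; identity = ⊕-identityˡ
                       , λ p → ≋-trans (⊕-comm p _) (⊕-identityˡ p) }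
          ; inverse = ⊝-inverseˡ
                    , λ p → ≋-trans (⊕-comm p _) (⊝-inverseˡ p)
          ; ⁻¹-cong = ⊝-cong }
        ; comm = ⊕-comm }
      ; *-cong = ⊗-cong
      ; *-assoc = ⊗-assoc
      ; *-identity = ⊗-identityˡ
                   , λ p → ≋-trans (⊗-comm p _) (⊗-identityˡ p)
      ; distrib = (λ p q r → ≋-trans (⊗-comm p _)
                    (≋-trans (⊗-distribʳ p q r)
                      (⊕-cong (⊗-comm q p) (⊗-comm r p))))
                , ⊗-distribʳ }
    ; *-comm = ⊗-comm } }

⊗-zeroˡ : (p : Poly U) → 0ₚ ⊗ p ≋ 0ₚ
⊗-zeroˡ {U = U} = CommutativeRing.zeroˡ (polyRing U)

⊗-zeroʳ : (p : Poly U) → p ⊗ 0ₚ ≋ 0ₚ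
⊗-zeroʳ {U = U} = CommutativeRing.zeroʳ (polyRing U)

≡⇒≋ : {p q : Poly U} → p ≡ q → p ≋ q
≡⇒≋ refl = ≋-refl

⟦_⟧ : Poly U → (U → ℤ) → ℤ
⟦ con c ⟧ ρ = c
⟦ var x ⟧ ρ = ρ x
⟦ p ⊕ q ⟧ ρ = ⟦ p ⟧ ρ ℤ.+ ⟦ q ⟧ ρ
⟦ p ⊗ q ⟧ ρ = ⟦ p ⟧ ρ ℤ.* ⟦ q ⟧ ρ
⟦ ⊝ p ⟧ ρ = ℤ.- ⟦ p ⟧ ρ

⟦⟧-cong : {p q : Poly U} (ρ : U → ℤ) → p ≋ q → ⟦ p ⟧ ρ ≡ ⟦ q ⟧ ρ
⟦⟧-cong ρ ≋-refl = refl
⟦⟧-cong ρ (≋-sym e) = sym (⟦⟧-cong ρ e)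
⟦⟧-cong ρ (≋-trans d e) = trans (⟦⟧-cong ρ d) (⟦⟧-cong ρ e)
⟦⟧-cong ρ (⊕-cong d e) = cong₂ ℤ._+_ (⟦⟧-cong ρ d) (⟦⟧-cong ρ e)
⟦⟧-cong ρ (⊗-cong d e) = cong₂ ℤ._*_ (⟦⟧-cong ρ d) (⟦⟧-cong ρ e)
⟦⟧-cong ρ (⊝-cong e) = cong ℤ.-_ (⟦⟧-cong ρ e)
⟦⟧-cong ρ (⊕-assoc p q r) = ℤ.+-assoc (⟦ p ⟧ ρ) (⟦ q ⟧ ρ) (⟦ r ⟧ ρ)
⟦⟧-cong ρ (⊕-comm p q) = ℤ.+-comm (⟦ p ⟧ ρ) (⟦ q ⟧ ρ)
⟦⟧-cong ρ (⊕-identityˡ p) = ℤ.+-identityˡ (⟦ p ⟧ ρ)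
⟦⟧-cong ρ (⊝-inverseˡ p) = ℤ.+-inverseˡ (⟦ p ⟧ ρ)
⟦⟧-cong ρ (⊗-assoc p q r) = ℤ.*-assoc (⟦ p ⟧ ρ) (⟦ q ⟧ ρ) (⟦ r ⟧ ρ)
⟦⟧-cong ρ (⊗-comm p q) = ℤ.*-comm (⟦ p ⟧ ρ) (⟦ q ⟧ ρ)
⟦⟧-cong ρ (⊗-identityˡ p) = ℤ.*-identityˡ (⟦ p ⟧ ρ)
⟦⟧-cong ρ (⊗-distribʳ p q r) =
  ℤ.*-distribʳ-+ (⟦ p ⟧ ρ) (⟦ q ⟧ ρ) (⟦ r ⟧ ρ)
⟦⟧-cong ρ (con-⊕ m n) = refl
⟦⟧-cong ρ (con-⊗ m n) = refl

rename : (U → V) → Poly U → Poly V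
rename φ (con c) = con c
rename φ (var x) = var (φ x)
rename φ (p ⊕ q) = rename φ p ⊕ rename φ q
rename φ (p ⊗ q) = rename φ p ⊗ rename φ q
rename φ (⊝ p) = ⊝ rename φ p

rename-cong : {p q : Poly U} (φ : U → V) → p ≋ q → rename φ p ≋ rename φ q
rename-cong φ ≋-refl = ≋-refl
rename-cong φ (≋-sym e) = ≋-sym (rename-cong φ e)
rename-cong φ (≋-trans d e) = ≋-trans (rename-cong φ d) (rename-cong φ e)
rename-cong φ (⊕-cong d e) = ⊕-cong (rename-cong φ d) (rename-cong φ e)
rename-cong φ (⊗-cong d e) = ⊗-cong (rename-cong φ d) (rename-cong φ e)
rename-cong φ (⊝-cong e) = ⊝-cong (rename-cong φ e)
rename-cong φ (⊕-assoc p q r) = ⊕-assoc _ _ _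
rename-cong φ (⊕-comm p q) = ⊕-comm _ _
rename-cong φ (⊕-identityˡ p) = ⊕-identityˡ _
rename-cong φ (⊝-inverseˡ p) = ⊝-inverseˡ _
rename-cong φ (⊗-assoc p q r) = ⊗-assoc _ _ _
rename-cong φ (⊗-comm p q) = ⊗-comm _ _
rename-cong φ (⊗-identityˡ p) = ⊗-identityˡ _
rename-cong φ (⊗-distribʳ p q r) = ⊗-distribʳ _ _ _
rename-cong φ (con-⊕ m n) = con-⊕ m n
rename-cong φ (con-⊗ m n) = con-⊗ m n

rename-∘ : ∀ {c} {W : Set c} {φ : V → W} {σ : U → V} {τ : U → W} →
           φ ∘ σ ≗ τ → rename φ ∘ rename σ ≗ rename τ
rename-∘ e (con c) = refl
rename-∘ e (var x) = cong var (e x)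
rename-∘ e (p ⊕ q) = cong₂ _⊕_ (rename-∘ e p) (rename-∘ e q)
rename-∘ e (p ⊗ q) = cong₂ _⊗_ (rename-∘ e p) (rename-∘ e q)
rename-∘ e (⊝ p) = cong ⊝_ (rename-∘ e p)

------------------------------------------------------------------------
-- ℤ[U] is an integral domain, so sums and products of fractions have
-- nonzero denominators.  For U = Fin n: a nonzero polynomial has
-- a nonzero leading coefficient in the variable zero, so it does not
-- vanish once that variable takes a large enough value.

private

  extend : ∀ {n} → ℤ → (Fin n → ℤ) → Fin (suc n) → ℤ
  extend x ρ zero = x
  extend x ρ (suc i) = ρ i

  ⟦⟧-rename-suc : ∀ {n} (p : Poly (Fin n)) x ρ →
                  ⟦ rename suc p ⟧ (extend x ρ) ≡ ⟦ p ⟧ ρ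
  ⟦⟧-rename-suc (con c) x ρ = refl
  ⟦⟧-rename-suc (var i) x ρ = refl
  ⟦⟧-rename-suc (p ⊕ q) x ρ =
    cong₂ ℤ._+_ (⟦⟧-rename-suc p x ρ) (⟦⟧-rename-suc q x ρ)
  ⟦⟧-rename-suc (p ⊗ q) x ρ =
    cong₂ ℤ._*_ (⟦⟧-rename-suc p x ρ) (⟦⟧-rename-suc q x ρ)
  ⟦⟧-rename-suc (⊝ p) x ρ = cong ℤ.-_ (⟦⟧-rename-suc p x ρ)

  con-⊝ : ∀ {a} {U : Set a} m → con {U = U} (ℤ.- m) ≋ ⊝ con m
  con-⊝ {U = U} m = GroupProperties.inverseˡ-unique +-group _ _
    (≋-trans (≋-sym (con-⊕ (ℤ.- m) m)) (≡⇒≋ (cong con (ℤ.+-inverseˡ m))))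
    where open CommutativeRing (polyRing U)

  constant : (p : Poly (Fin 0)) (ρ : Fin 0 → ℤ) → p ≋ con (⟦ p ⟧ ρ)
  constant (con c) ρ = ≋-refl
  constant (p ⊕ q) ρ =
    ≋-trans (⊕-cong (constant p ρ) (constant q ρ)) (≋-sym (con-⊕ _ _))
  constant (p ⊗ q) ρ =
    ≋-trans (⊗-cong (constant p ρ) (constant q ρ)) (≋-sym (con-⊗ _ _))
  constant (⊝ p) ρ = ≋-trans (⊝-cong (constant p ρ)) (≋-sym (con-⊝ _))

  module Coefficients {n : ℕ} where

    Coeffs : Set
    Coeffs = List (Poly (Fin n))

    open CommutativeRing (polyRing (Fin (suc n)))
      using (commutativeSemiring; ring)
    open SemiringSolver commutativeSemiring

    x₀ : Poly (Fin (suc n))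
    x₀ = var zero

    horner : Coeffs → Poly (Fin (suc n))
    horner [] = 0ₚ
    horner (c ∷ cs) = rename suc c ⊕ x₀ ⊗ horner cs

    addᶜ : Coeffs → Coeffs → Coeffs
    addᶜ [] ds = ds
    addᶜ (c ∷ cs) [] = c ∷ cs
    addᶜ (c ∷ cs) (d ∷ ds) = (c ⊕ d) ∷ addᶜ cs ds

    scaleᶜ : Poly (Fin n) → Coeffs → Coeffs
    scaleᶜ e = List.map (e ⊗_)

    mulᶜ : Coeffs → Coeffs → Coeffs
    mulᶜ [] ds = []
    mulᶜ (c ∷ cs) ds = addᶜ (scaleᶜ c ds) (0ₚ ∷ mulᶜ cs ds)

    horner-add : ∀ cs ds → horner (addᶜ cs ds) ≋ horner cs ⊕ horner ds
    horner-add [] ds = ≋-sym (⊕-identityˡ _)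
    horner-add (c ∷ cs) [] = ≋-sym (≋-trans (⊕-comm _ _) (⊕-identityˡ _))
    horner-add (c ∷ cs) (d ∷ ds) =
      ≋-trans (⊕-cong ≋-refl (⊗-cong ≋-refl (horner-add cs ds)))
        (solve 5 (λ c d x p q → (c :+ d) :+ x :* (p :+ q)
                             := (c :+ x :* p) :+ (d :+ x :* q)) ≋-refl
          (rename suc c) (rename suc d) x₀ (horner cs) (horner ds))

    horner-scale : ∀ e cs → horner (scaleᶜ e cs) ≋ rename suc e ⊗ horner cs
    horner-scale e [] = ≋-sym (⊗-zeroʳ _)
    horner-scale e (c ∷ cs) =
      ≋-trans (⊕-cong ≋-refl (⊗-cong ≋-refl (horner-scale e cs)))
        (solve 4 (λ e c x p → e :* c :+ x :* (e :* p)
                           := e :* (c :+ x :* p)) ≋-refl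
          (rename suc e) (rename suc c) x₀ (horner cs))

    horner-mul : ∀ cs ds → horner (mulᶜ cs ds) ≋ horner cs ⊗ horner ds
    horner-mul [] ds = ≋-sym (⊗-zeroˡ _)
    horner-mul (c ∷ cs) ds =
      ≋-trans (horner-add (scaleᶜ c ds) (0ₚ ∷ mulᶜ cs ds))
        (≋-trans (⊕-cong (horner-scale c ds)
          (≋-trans (⊕-identityˡ _) (⊗-cong ≋-refl (horner-mul cs ds))))
          (solve 4 (λ c x p q → c :* q :+ x :* (p :* q)
                             := (c :+ x :* p) :* q) ≋-refl
            (rename suc c) x₀ (horner cs) (horner ds)))

    horner-const : ∀ c → horner (c ∷ []) ≋ rename suc c
    horner-const c = ≋-trans (⊕-cong ≋-refl (⊗-zeroʳ _))
      (≋-trans (⊕-comm _ _) (⊕-identityˡ _))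

    coeffs : (p : Poly (Fin (suc n))) → ∃[ cs ] p ≋ horner cs
    coeffs (con c) = con c ∷ [] , ≋-sym (horner-const (con c))
    coeffs (var zero) = 0ₚ ∷ 1ₚ ∷ [] , ≋-sym
      (≋-trans (⊕-identityˡ _) (≋-trans (⊗-cong ≋-refl (horner-const 1ₚ))
        (≋-trans (⊗-comm _ _) (⊗-identityˡ _))))
    coeffs (var (suc i)) = var i ∷ [] , ≋-sym (horner-const (var i))
    coeffs (p ⊕ q) with coeffs p | coeffs q
    ... | cs , e | ds , e′ =
      addᶜ cs ds , ≋-trans (⊕-cong e e′) (≋-sym (horner-add cs ds))
    coeffs (p ⊗ q) with coeffs p | coeffs q
    ... | cs , e | ds , e′ =
      mulᶜ cs ds , ≋-trans (⊗-cong e e′) (≋-sym (horner-mul cs ds))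
    coeffs (⊝ p) with coeffs p
    ... | cs , e = scaleᶜ (⊝ 1ₚ) cs ,
      ≋-trans (⊝-cong e) (≋-trans
        (≋-sym (RingProperties.-1*x≈-x ring (horner cs)))
        (≋-sym (horner-scale (⊝ 1ₚ) cs)))

  open Coefficients

  dominated : ∀ c v N → ¬ v ≡ + 0 → ∣ c ∣ < N → ¬ c ℤ.+ + N ℤ.* v ≡ + 0
  dominated c v N v≢0 c<N e = ℕ.<-irrefl refl
    (ℕ.<-≤-trans c<N (ℕ.≤-trans (ℕ.m≤m*n N ∣ v ∣) (ℕ.≤-reflexive (sym ∣c∣))))
    where
    instance
      nz : ℕ.NonZero ∣ v ∣
      nz = ℕ.≢-nonZero (v≢0 ∘ ℤ.∣i∣≡0⇒i≡0)
    ∣c∣ : ∣ c ∣ ≡ N ℕ.* ∣ v ∣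
    ∣c∣ = trans (cong ∣_∣ (GroupProperties.inverseˡ-unique (AbelianGroup.group ℤ.+-0-abelianGroup) c _ e))
            (trans (ℤ.∣-i∣≡∣i∣ (+ N ℤ.* v)) (ℤ.abs-* (+ N) v))

  Leading : ∀ {n} → Poly (Fin n) → Poly (Fin (suc n)) → Set
  Leading c p = ∀ ρ → ¬ ⟦ c ⟧ ρ ≡ + 0 →
    ∃[ N₀ ] (∀ N → N₀ ≤ N → ¬ ⟦ p ⟧ (extend (+ N) ρ) ≡ + 0)

  CommonNonzero : ∀ {n} → Poly (Fin n) → Poly (Fin n) → Set
  CommonNonzero p q = ∃[ ρ ] (¬ ⟦ p ⟧ ρ ≡ + 0 × ¬ ⟦ q ⟧ ρ ≡ + 0)

  leadingᶜ : ∀ {n} →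
    ((c : Poly (Fin n)) → c ≋ 0ₚ ⊎ ¬ c ≋ 0ₚ) → (cs : List (Poly (Fin n))) →
    horner cs ≋ 0ₚ ⊎ (∃[ c ] (¬ c ≋ 0ₚ × Leading c (horner cs)))
  leadingᶜ dec [] = inj₁ ≋-refl
  leadingᶜ dec (c ∷ cs) with leadingᶜ dec cs
  ... | inj₂ (d , d≉0 , lead) = inj₂ (d , d≉0 , λ ρ nz →
    let N₀ , big = lead ρ nz in
    N₀ ⊔ suc ∣ ⟦ c ⟧ ρ ∣ , λ N N₀≤N e →
      dominated (⟦ c ⟧ ρ) (⟦ horner cs ⟧ (extend (+ N) ρ)) N
        (big N (ℕ.m⊔n≤o⇒m≤o N₀ _ N₀≤N)) (ℕ.m⊔n≤o⇒n≤o N₀ _ N₀≤N)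
        (trans (cong (ℤ._+ _) (sym (⟦⟧-rename-suc c (+ N) ρ))) e))
  ... | inj₁ cs≋0 with dec c
  ...   | inj₁ c≋0 = inj₁ (≋-trans
    (⊕-cong (rename-cong suc c≋0) (≋-trans (⊗-cong ≋-refl cs≋0) (⊗-zeroʳ _)))
    (⊕-identityˡ _))
  ...   | inj₂ c≉0 = inj₂ (c , c≉0 , λ ρ nz → 0 , λ N _ e →
    nz (trans (sym (value (extend (+ N) ρ) (⟦⟧-rename-suc c (+ N) ρ))) e))
    where
    value : ∀ ρ′ {x} → ⟦ rename suc c ⟧ ρ′ ≡ x → ⟦ horner (c ∷ cs) ⟧ ρ′ ≡ x
    value ρ′ e = trans (cong₂ ℤ._+_ e
      (trans (cong (ρ′ zero ℤ.*_) (⟦⟧-cong ρ′ cs≋0)) (ℤ.*-zeroʳ (ρ′ zero))))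
      (ℤ.+-identityʳ _)

  leading : ∀ {n} →
    ((c : Poly (Fin n)) → c ≋ 0ₚ ⊎ ¬ c ≋ 0ₚ) → (p : Poly (Fin (suc n))) →
    p ≋ 0ₚ ⊎ (∃[ c ] (¬ c ≋ 0ₚ × Leading c p))
  leading dec p with coeffs p
  ... | cs , e with leadingᶜ dec cs
  ...   | inj₁ z = inj₁ (≋-trans e z)
  ...   | inj₂ (c , c≉0 , lead) = inj₂ (c , c≉0 , λ ρ nz →
    let N₀ , big = lead ρ nz in
    N₀ , λ N le v → big N le (trans (sym (⟦⟧-cong _ e)) v))

  commonNonzero : ∀ n (p q : Poly (Fin n)) →
                  p ≋ 0ₚ ⊎ q ≋ 0ₚ ⊎ CommonNonzero p q
  zero? : ∀ n (p : Poly (Fin n)) → p ≋ 0ₚ ⊎ ¬ p ≋ 0ₚ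

  zero? n p with commonNonzero n p p
  ... | inj₁ z = inj₁ z
  ... | inj₂ (inj₁ z) = inj₁ z
  ... | inj₂ (inj₂ (ρ , nz , _)) = inj₂ (nz ∘ ⟦⟧-cong ρ)

  commonNonzero zero p q with ⟦ p ⟧ (λ ()) ℤ.≟ + 0 | ⟦ q ⟧ (λ ()) ℤ.≟ + 0
  ... | yes e | _ = inj₁ (≋-trans (constant p _) (≡⇒≋ (cong con e)))
  ... | no _ | yes e = inj₂ (inj₁ (≋-trans (constant q _) (≡⇒≋ (cong con e))))
  ... | no p≢0 | no q≢0 = inj₂ (inj₂ (_ , p≢0 , q≢0))
  commonNonzero (suc n) p q with leading (zero? n) p | leading (zero? n) q
  ... | inj₁ z | _ = inj₁ z
  ... | inj₂ _ | inj₁ z = inj₂ (inj₁ z)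
  ... | inj₂ (c , c≉0 , leadp) | inj₂ (d , d≉0 , leadq)
    with commonNonzero n c d
  ...   | inj₁ z = contradiction z c≉0
  ...   | inj₂ (inj₁ z) = contradiction z d≉0
  ...   | inj₂ (inj₂ (ρ , nzc , nzd)) =
    let M , bigp = leadp ρ nzc
        N , bigq = leadq ρ nzd
    in inj₂ (inj₂ (extend (+ (M ⊔ N)) ρ
         , bigp (M ⊔ N) (ℕ.m≤m⊔n M N) , bigq (M ⊔ N) (ℕ.m≤n⊔m M N)))

  integral-Fin : ∀ {n} (p q : Poly (Fin n)) →
                 p ⊗ q ≋ 0ₚ → p ≋ 0ₚ ⊎ q ≋ 0ₚ
  integral-Fin {n} p q e with commonNonzero n p q
  ... | inj₁ z = inj₁ z
  ... | inj₂ (inj₁ z) = inj₂ z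
  ... | inj₂ (inj₂ (ρ , nzp , nzq)) =
    ⊥-elim ([ nzp , nzq ]′ (ℤ.i*j≡0⇒i≡0∨j≡0 (⟦ p ⟧ ρ) (⟦⟧-cong ρ e)))

-- For arbitrary U, without assuming decidable equality on U: every
-- derivation of p ≋ q is the image of one over finitely many variables.

private

  record Lift {a} {U : Set a} (p q : Poly U) : Set a where
    constructor lift
    field
      {n}   : ℕ
      φ     : Fin n → U
      p′ q′ : Poly (Fin n)
      p′≡p  : rename φ p′ ≡ p
      q′≡q  : rename φ q′ ≡ q
      p′≋q′ : p′ ≋ q′

  join : ∀ {m n} → (Fin m → U) → (Fin n → U) → Fin (m ℕ.+ n) → U
  join {m = m} φ ψ i = [ φ , ψ ]′ (splitAt m i)

  join-ˡ : ∀ {m n} (φ : Fin m → U) (ψ : Fin n → U) →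
           join φ ψ ∘ (_↑ˡ n) ≗ φ
  join-ˡ {m = m} {n} φ ψ i = cong [ φ , ψ ]′ (Fin.splitAt-↑ˡ m i n)

  join-ʳ : ∀ {m n} (φ : Fin m → U) (ψ : Fin n → U) →
           join φ ψ ∘ (m ↑ʳ_) ≗ ψ
  join-ʳ {m = m} {n} φ ψ i = cong [ φ , ψ ]′ (Fin.splitAt-↑ʳ m n i)

  substVar : ∀ {n} → Fin n → Fin n → Fin n → Fin n
  substVar i j x = if does (x Fin.≟ i) then j else x

  substVar-φ : ∀ {n} (φ : Fin n → U) {i j} → φ i ≡ φ j →
               φ ∘ substVar i j ≗ φ
  substVar-φ φ {i} {j} e x with x Fin.≟ i
  ... | yes refl = sym e
  ... | no _ = refl

  substVar-≡ : ∀ {n} (i j : Fin n) → substVar i j i ≡ substVar i j j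
  substVar-≡ i j with i Fin.≟ i | j Fin.≟ i
  ... | yes _ | yes _ = refl
  ... | yes _ | no _ = refl
  ... | no i≢i | _ = contradiction refl i≢i

  ⊕-inj : {p q r s : Poly U} → p ⊕ q ≡ r ⊕ s → p ≡ r × q ≡ s
  ⊕-inj refl = refl , refl

  ⊗-inj : {p q r s : Poly U} → p ⊗ q ≡ r ⊗ s → p ≡ r × q ≡ s
  ⊗-inj refl = refl , refl

  merge : ∀ {n} (φ : Fin n → U) τ → φ ∘ τ ≗ φ →
          ∀ p q → rename φ p ≡ rename φ q →
          ∃[ σ ] (φ ∘ σ ≗ φ × rename (σ ∘ τ) p ≡ rename (σ ∘ τ) q)
  merge₂ : ∀ {n} (φ : Fin n → U) τ → φ ∘ τ ≗ φ →
           ∀ p q r s → rename φ p ≡ rename φ r → rename φ q ≡ rename φ s →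
           ∃[ σ ] (φ ∘ σ ≗ φ × rename (σ ∘ τ) p ≡ rename (σ ∘ τ) r
                             × rename (σ ∘ τ) q ≡ rename (σ ∘ τ) s)

  merge φ τ k (con c) (con .c) refl = id , (λ _ → refl) , refl
  merge φ τ k (var i) (var j) e =
    substVar (τ i) (τ j)
    , substVar-φ φ (trans (k i) (trans (var-inj e) (sym (k j))))
    , cong var (substVar-≡ (τ i) (τ j))
    where
    var-inj : ∀ {x y} → var x ≡ var y → x ≡ y
    var-inj refl = refl
  merge φ τ k (p ⊕ q) (r ⊕ s) e =
    let e₁ , e₂ = ⊕-inj e
        σ , h , f₁ , f₂ = merge₂ φ τ k p q r s e₁ e₂
    in σ , h , cong₂ _⊕_ f₁ f₂
  merge φ τ k (p ⊗ q) (r ⊗ s) e =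
    let e₁ , e₂ = ⊗-inj e
        σ , h , f₁ , f₂ = merge₂ φ τ k p q r s e₁ e₂
    in σ , h , cong₂ _⊗_ f₁ f₂
  merge φ τ k (⊝ p) (⊝ q) e =
    let σ , h , f = merge φ τ k p q (⊝-inj e) in σ , h , cong ⊝_ f
    where
    ⊝-inj : ∀ {p q} → ⊝ p ≡ ⊝ q → p ≡ q
    ⊝-inj refl = refl

  merge₂ φ τ k p q r s e₁ e₂ =
    let σ , h , f = merge φ τ k p r e₁
        σ′ , h′ , g = merge φ (σ ∘ τ) (λ x → trans (h (τ x)) (k x)) q s e₂
        comp : ∀ t → rename σ′ (rename (σ ∘ τ) t) ≡ rename (σ′ ∘ σ ∘ τ) t
        comp = rename-∘ (λ _ → refl)
    in σ′ ∘ σ , (λ x → trans (h′ (σ x)) (h x))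
       , trans (sym (comp p)) (trans (cong (rename σ′) f) (comp r))
       , g

  liftTerm : (p : Poly U) → Lift p p
  lift₂ : {p q r s : Poly U} → Lift p q → Lift r s →
          (_∙_ : ∀ {a} {U : Set a} → Poly U → Poly U → Poly U) →
          (∀ {n} (φ : Fin n → U) p q →
             rename φ (p ∙ q) ≡ rename φ p ∙ rename φ q) →
          (∀ {n} {p q r s : Poly (Fin n)} →
             p ≋ q → r ≋ s → p ∙ r ≋ q ∙ s) →
          Lift (p ∙ r) (q ∙ s)
  lift₂ (lift {m} φ p′ q′ p≡ q≡ e) (lift {n} ψ r′ s′ r≡ s≡ e′) _∙_ hom ∙-cong =
    lift (join φ ψ)
      (rename (_↑ˡ n) p′ ∙ rename (m ↑ʳ_) r′)
      (rename (_↑ˡ n) q′ ∙ rename (m ↑ʳ_) s′)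
      (trans (hom _ _ _) (cong₂ _∙_
        (trans (rename-∘ (join-ˡ φ ψ) p′) p≡)
        (trans (rename-∘ (join-ʳ φ ψ) r′) r≡)))
      (trans (hom _ _ _) (cong₂ _∙_
        (trans (rename-∘ (join-ˡ φ ψ) q′) q≡)
        (trans (rename-∘ (join-ʳ φ ψ) s′) s≡)))
      (∙-cong (rename-cong _ e) (rename-cong _ e′))

  _⊕ᴸ_ : {p q r s : Poly U} → Lift p q → Lift r s → Lift (p ⊕ r) (q ⊕ s)
  d ⊕ᴸ e = lift₂ d e _⊕_ (λ _ _ _ → refl) ⊕-cong

  _⊗ᴸ_ : {p q r s : Poly U} → Lift p q → Lift r s → Lift (p ⊗ r) (q ⊗ s)
  d ⊗ᴸ e = lift₂ d e _⊗_ (λ _ _ _ → refl) ⊗-cong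

  ⊝ᴸ_ : {p q : Poly U} → Lift p q → Lift (⊝ p) (⊝ q)
  ⊝ᴸ lift φ p′ q′ p≡ q≡ e =
    lift φ (⊝ p′) (⊝ q′) (cong ⊝_ p≡) (cong ⊝_ q≡) (⊝-cong e)

  liftTerm (con c) = lift {n = 0} (λ ()) (con c) (con c) refl refl ≋-refl
  liftTerm (var x) =
    lift {n = 1} (λ _ → x) (var zero) (var zero) refl refl ≋-refl
  liftTerm (p ⊕ q) = liftTerm p ⊕ᴸ liftTerm q
  liftTerm (p ⊗ q) = liftTerm p ⊗ᴸ liftTerm q
  liftTerm (⊝ p) = ⊝ᴸ liftTerm p

  transᴸ : {p q r : Poly U} → Lift p q → Lift q r → Lift p r
  transᴸ (lift {m} φ p′ q′ p≡ q≡ e) (lift {n} ψ q″ r′ q″≡ r≡ e′) =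
    let χ = join φ ψ
        toˡ : ∀ t → rename χ (rename (_↑ˡ n) t) ≡ rename φ t
        toˡ = rename-∘ (join-ˡ φ ψ)
        toʳ : ∀ t → rename χ (rename (m ↑ʳ_) t) ≡ rename ψ t
        toʳ = rename-∘ (join-ʳ φ ψ)
        σ , h , f = merge χ id (λ _ → refl) (rename (_↑ˡ n) q′) (rename (m ↑ʳ_) q″)
          (trans (toˡ q′) (trans q≡ (trans (sym q″≡) (sym (toʳ q″)))))
    in lift χ (rename σ (rename (_↑ˡ n) p′)) (rename σ (rename (m ↑ʳ_) r′))
         (trans (rename-∘ h (rename (_↑ˡ n) p′)) (trans (toˡ p′) p≡))
         (trans (rename-∘ h (rename (m ↑ʳ_) r′)) (trans (toʳ r′) r≡))
         (≋-trans (rename-cong σ (rename-cong _ e)) (≋-trans (≡⇒≋ f)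
           (rename-cong σ (rename-cong _ e′))))

  record Triple {a} {U : Set a} (p q r : Poly U) : Set a where
    constructor triple
    field
      {n}      : ℕ
      φ        : Fin n → U
      p′ q′ r′ : Poly (Fin n)
      p≡       : rename φ p′ ≡ p
      q≡       : rename φ q′ ≡ q
      r≡       : rename φ r′ ≡ r

  liftTriple : (p q r : Poly U) → Triple p q r
  liftTriple p q r with liftTerm ((p ⊕ q) ⊕ r)
  ... | lift φ ((p′ ⊕ q′) ⊕ r′) _ refl _ _ = triple φ p′ q′ r′ refl refl refl

  liftEq : {p q : Poly U} → p ≋ q → Lift p q
  liftEq ≋-refl = liftTerm _
  liftEq (≋-sym e) with liftEq e
  ... | lift φ p′ q′ p≡ q≡ d = lift φ q′ p′ q≡ p≡ (≋-sym d)
  liftEq (≋-trans d e) = transᴸ (liftEq d) (liftEq e)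
  liftEq (⊕-cong d e) = liftEq d ⊕ᴸ liftEq e
  liftEq (⊗-cong d e) = liftEq d ⊗ᴸ liftEq e
  liftEq (⊝-cong e) = ⊝ᴸ liftEq e
  liftEq (⊕-assoc p q r) with liftTriple p q r
  ... | triple φ p′ q′ r′ refl refl refl =
    lift φ _ _ refl refl (⊕-assoc p′ q′ r′)
  liftEq (⊕-comm p q) with liftTriple p q q
  ... | triple φ p′ q′ _ refl refl _ = lift φ _ _ refl refl (⊕-comm p′ q′)
  liftEq (⊕-identityˡ p) with liftTriple p p p
  ... | triple φ p′ _ _ refl _ _ = lift φ _ _ refl refl (⊕-identityˡ p′)
  liftEq (⊝-inverseˡ p) with liftTriple p p p
  ... | triple φ p′ _ _ refl _ _ = lift φ _ _ refl refl (⊝-inverseˡ p′)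
  liftEq (⊗-assoc p q r) with liftTriple p q r
  ... | triple φ p′ q′ r′ refl refl refl =
    lift φ _ _ refl refl (⊗-assoc p′ q′ r′)
  liftEq (⊗-comm p q) with liftTriple p q q
  ... | triple φ p′ q′ _ refl refl _ = lift φ _ _ refl refl (⊗-comm p′ q′)
  liftEq (⊗-identityˡ p) with liftTriple p p p
  ... | triple φ p′ _ _ refl _ _ = lift φ _ _ refl refl (⊗-identityˡ p′)
  liftEq (⊗-distribʳ p q r) with liftTriple p q r
  ... | triple φ p′ q′ r′ refl refl refl =
    lift φ _ _ refl refl (⊗-distribʳ p′ q′ r′)
  liftEq (con-⊕ m n) = lift {n = 0} (λ ()) _ _ refl refl (con-⊕ m n)
  liftEq (con-⊗ m n) = lift {n = 0} (λ ()) _ _ refl refl (con-⊗ m n)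

integral : (p q : Poly U) → p ⊗ q ≋ 0ₚ → p ≋ 0ₚ ⊎ q ≋ 0ₚ
integral p q e with liftEq e
... | lift φ (p′ ⊗ q′) (con _) refl refl d =
  Sum.map (rename-cong φ) (rename-cong φ) (integral-Fin p′ q′ d)

⊗-nonzero : {p q : Poly U} → ¬ p ≋ 0ₚ → ¬ q ≋ 0ₚ → ¬ p ⊗ q ≋ 0ₚ
⊗-nonzero p≉0 q≉0 = [ p≉0 , q≉0 ]′ ∘ integral _ _

⊗-cancelˡ : {d p q : Poly U} → ¬ d ≋ 0ₚ → d ⊗ p ≋ d ⊗ q → p ≋ q
⊗-cancelˡ {U = U} {d} {p} {q} d≉0 e =
  [ ⊥-elim ∘ d≉0 , RingProperties.x∙y⁻¹≈ε⇒x≈y ring p q ]′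
    (integral d (p ⊕ ⊝ q) d[p-q]≋0)
  where
  open CommutativeRing (polyRing U) using (ring; distribˡ; -‿inverseʳ)
  d[p-q]≋0 : d ⊗ (p ⊕ ⊝ q) ≋ 0ₚ
  d[p-q]≋0 = ≋-trans (distribˡ d p (⊝ q)) (≋-trans
    (⊕-cong e (≋-sym (RingProperties.-‿distribʳ-* ring d q))) (-‿inverseʳ _))

1≉0 : ¬ 1ₚ {U = U} ≋ 0ₚ
1≉0 e with () ← ⟦⟧-cong (λ _ → + 0) e

------------------------------------------------------------------------
-- The field ℤ(U) of rational functions: fractions over ℤ[U], compared by
-- cross-multiplication.

infixl 6 _+ᶠ_
infixl 7 _*ᶠ_
infix  8 -ᶠ_
infix  4 _≃_

record Frac (U : Set a) : Set a where
  constructor frac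
  field
    num   : Poly U
    den   : Poly U
    den≉0 : ¬ den ≋ 0ₚ

open Frac public

_≃_ : {U : Set a} → Frac U → Frac U → Set a
x ≃ y = num x ⊗ den y ≋ num y ⊗ den x

fromPoly : Poly U → Frac U
fromPoly p = frac p 1ₚ 1≉0

fromℕ : ℕ → Frac U
fromℕ n = fromPoly (con (+ n))

0ᶠ 1ᶠ : Frac U
0ᶠ = fromℕ 0
1ᶠ = fromℕ 1

1/ : (p : Poly U) → ¬ p ≋ 0ₚ → Frac U
1/ p p≉0 = frac 1ₚ p p≉0

_+ᶠ_ _*ᶠ_ : Frac U → Frac U → Frac U
frac p d d≉0 +ᶠ frac q e e≉0 = frac (p ⊗ e ⊕ q ⊗ d) (d ⊗ e) (⊗-nonzero d≉0 e≉0)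
frac p d d≉0 *ᶠ frac q e e≉0 = frac (p ⊗ q) (d ⊗ e) (⊗-nonzero d≉0 e≉0)

-ᶠ_ : Frac U → Frac U
-ᶠ frac p d d≉0 = frac (⊝ p) d d≉0

private
  module FracLaws {a} (U : Set a) where
    open CommutativeRing (polyRing U)
      using (commutativeSemiring; ring; setoid)
    open SemiringSolver commutativeSemiring
    open import Relation.Binary.Reasoning.Setoid setoid

    ≃-trans : {x y z : Frac U} → x ≃ y → y ≃ z → x ≃ z
    ≃-trans {frac p d _} {frac q e e≉0} {frac r f _} h k =
      ⊗-cancelˡ e≉0 (begin
        e ⊗ (p ⊗ f)  ≈⟨ solve 3 (λ e p f → e :* (p :* f) := (p :* e) :* f)
                          ≋-refl e p f ⟩
        (p ⊗ e) ⊗ f  ≈⟨ ⊗-cong h ≋-refl ⟩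
        (q ⊗ d) ⊗ f  ≈⟨ solve 3 (λ q d f → (q :* d) :* f := (q :* f) :* d)
                          ≋-refl q d f ⟩
        (q ⊗ f) ⊗ d  ≈⟨ ⊗-cong k ≋-refl ⟩
        (r ⊗ e) ⊗ d  ≈⟨ solve 3 (λ r e d → (r :* e) :* d := e :* (r :* d))
                          ≋-refl r e d ⟩
        e ⊗ (r ⊗ d)  ∎)

    +-cong : {x x′ y y′ : Frac U} → x ≃ x′ → y ≃ y′ → x +ᶠ y ≃ x′ +ᶠ y′
    +-cong {frac p d _} {frac p′ d′ _} {frac q e _} {frac q′ e′ _} h k =
      begin
        (p ⊗ e ⊕ q ⊗ d) ⊗ (d′ ⊗ e′)
          ≈⟨ solve 6 (λ p d d′ q e e′ → (p :* e :+ q :* d) :* (d′ :* e′)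
               := (p :* d′) :* (e :* e′) :+ (q :* e′) :* (d :* d′))
               ≋-refl p d d′ q e e′ ⟩
        (p ⊗ d′) ⊗ (e ⊗ e′) ⊕ (q ⊗ e′) ⊗ (d ⊗ d′)
          ≈⟨ ⊕-cong (⊗-cong h ≋-refl) (⊗-cong k ≋-refl) ⟩
        (p′ ⊗ d) ⊗ (e ⊗ e′) ⊕ (q′ ⊗ e) ⊗ (d ⊗ d′)
          ≈⟨ solve 6 (λ p′ d d′ q′ e e′ →
               (p′ :* d) :* (e :* e′) :+ (q′ :* e) :* (d :* d′)
               := (p′ :* e′ :+ q′ :* d′) :* (d :* e))
               ≋-refl p′ d d′ q′ e e′ ⟩
        (p′ ⊗ e′ ⊕ q′ ⊗ d′) ⊗ (d ⊗ e) ∎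

    *-cong : {x x′ y y′ : Frac U} → x ≃ x′ → y ≃ y′ → x *ᶠ y ≃ x′ *ᶠ y′
    *-cong {frac p d _} {frac p′ d′ _} {frac q e _} {frac q′ e′ _} h k =
      begin
        (p ⊗ q) ⊗ (d′ ⊗ e′)
          ≈⟨ solve 4 (λ p q d′ e′ →
               (p :* q) :* (d′ :* e′) := (p :* d′) :* (q :* e′))
               ≋-refl p q d′ e′ ⟩
        (p ⊗ d′) ⊗ (q ⊗ e′) ≈⟨ ⊗-cong h k ⟩
        (p′ ⊗ d) ⊗ (q′ ⊗ e)
          ≈⟨ solve 4 (λ p′ d q′ e →
               (p′ :* d) :* (q′ :* e) := (p′ :* q′) :* (d :* e))
               ≋-refl p′ d q′ e ⟩
        (p′ ⊗ q′) ⊗ (d ⊗ e) ∎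

    -‿cong : {x x′ : Frac U} → x ≃ x′ → -ᶠ x ≃ -ᶠ x′
    -‿cong {frac p d _} {frac p′ d′ _} h = begin
      (⊝ p) ⊗ d′   ≈⟨ RingProperties.-‿distribˡ-* ring p d′ ⟨
      ⊝ (p ⊗ d′)   ≈⟨ ⊝-cong h ⟩
      ⊝ (p′ ⊗ d)   ≈⟨ RingProperties.-‿distribˡ-* ring p′ d ⟩
      (⊝ p′) ⊗ d   ∎

    +-assoc : (x y z : Frac U) → (x +ᶠ y) +ᶠ z ≃ x +ᶠ (y +ᶠ z)
    +-assoc (frac p d _) (frac q e _) (frac r f _) =
      solve 6 (λ p d q e r f →
        ((p :* e :+ q :* d) :* f :+ r :* (d :* e)) :* (d :* (e :* f))
        := (p :* (e :* f) :+ (q :* f :+ r :* e) :* d) :* ((d :* e) :* f))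
        ≋-refl p d q e r f

    +-comm : (x y : Frac U) → x +ᶠ y ≃ y +ᶠ x
    +-comm (frac p d _) (frac q e _) =
      solve 4 (λ p d q e → (p :* e :+ q :* d) :* (e :* d)
                        := (q :* d :+ p :* e) :* (d :* e)) ≋-refl p d q e

    +-identityˡ : (x : Frac U) → 0ᶠ +ᶠ x ≃ x
    +-identityˡ (frac p d _) = ⊗-cong
      (≋-trans (⊕-cong (⊗-zeroˡ d) (≋-trans (⊗-comm p 1ₚ) (⊗-identityˡ p)))
        (⊕-identityˡ p))
      (≋-sym (⊗-identityˡ d))

    +-inverseˡ : (x : Frac U) → (-ᶠ x) +ᶠ x ≃ 0ᶠ
    +-inverseˡ (frac p d _) = begin
      ((⊝ p) ⊗ d ⊕ p ⊗ d) ⊗ 1ₚ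
        ≈⟨ ⊗-cong (⊗-distribʳ d (⊝ p) p) ≋-refl ⟨
      ((⊝ p ⊕ p) ⊗ d) ⊗ 1ₚ
        ≈⟨ ⊗-cong (⊗-cong (⊝-inverseˡ p) ≋-refl) ≋-refl ⟩
      (0ₚ ⊗ d) ⊗ 1ₚ       ≈⟨ ⊗-cong (⊗-zeroˡ d) ≋-refl ⟩
      0ₚ ⊗ 1ₚ             ≈⟨ ⊗-zeroˡ 1ₚ ⟩
      0ₚ                  ≈⟨ ⊗-zeroˡ (d ⊗ d) ⟨
      0ₚ ⊗ (d ⊗ d)        ∎

    *-assoc : (x y z : Frac U) → (x *ᶠ y) *ᶠ z ≃ x *ᶠ (y *ᶠ z)
    *-assoc (frac p d _) (frac q e _) (frac r f _) =
      ⊗-cong (⊗-assoc p q r) (≋-sym (⊗-assoc d e f))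

    *-comm : (x y : Frac U) → x *ᶠ y ≃ y *ᶠ x
    *-comm (frac p d _) (frac q e _) = ⊗-cong (⊗-comm p q) (⊗-comm e d)

    *-identityˡ : (x : Frac U) → 1ᶠ *ᶠ x ≃ x
    *-identityˡ (frac p d _) = ⊗-cong (⊗-identityˡ p) (≋-sym (⊗-identityˡ d))

    distribʳ : (x y z : Frac U) → (y +ᶠ z) *ᶠ x ≃ y *ᶠ x +ᶠ z *ᶠ x
    distribʳ (frac p d _) (frac q e _) (frac r f _) =
      solve 6 (λ p d q e r f →
        ((q :* f :+ r :* e) :* p) :* ((e :* d) :* (f :* d))
        := ((q :* p) :* (f :* d) :+ (r :* p) :* (e :* d)) :* ((e :* f) :* d))
        ≋-refl p d q e r f

fracRing : Set a → CommutativeRing a a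
fracRing U = record
  { Carrier = Frac U ; _≈_ = _≃_
  ; _+_ = _+ᶠ_ ; _*_ = _*ᶠ_ ; -_ = -ᶠ_ ; 0# = 0ᶠ ; 1# = 1ᶠ
  ; isCommutativeRing = record
    { isRing = record
      { +-isAbelianGroup = record
        { isGroup = record
          { isMonoid = record
            { isSemigroup = record
              { isMagma = record
                { isEquivalence = record
                  { refl = ≋-refl ; sym = ≋-sym
                  ; trans = λ {x} {y} {z} → ≃-trans {x} {y} {z} }
                ; ∙-cong = λ {x} {x′} {y} {y′} → +-cong {x} {x′} {y} {y′} }
              ; assoc = +-assoc }
            ; identity = +-identityˡ , λ x →
                ≃-trans {x +ᶠ 0ᶠ} {0ᶠ +ᶠ x} {x} (+-comm x 0ᶠ) (+-identityˡ x) }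
          ; inverse = +-inverseˡ , λ x →
              ≃-trans {x +ᶠ -ᶠ x} { -ᶠ x +ᶠ x} {0ᶠ}
                (+-comm x (-ᶠ x)) (+-inverseˡ x)
          ; ⁻¹-cong = λ {x} {x′} → -‿cong {x} {x′} }
        ; comm = +-comm }
      ; *-cong = λ {x} {x′} {y} {y′} → *-cong {x} {x′} {y} {y′}
      ; *-assoc = *-assoc
      ; *-identity = *-identityˡ , λ x →
          ≃-trans {x *ᶠ 1ᶠ} {1ᶠ *ᶠ x} {x} (*-comm x 1ᶠ) (*-identityˡ x)
      ; distrib = (λ x y z → ≃-trans {x *ᶠ (y +ᶠ z)} {(y +ᶠ z) *ᶠ x}
                      {x *ᶠ y +ᶠ x *ᶠ z} (*-comm x (y +ᶠ z))
                    (≃-trans {(y +ᶠ z) *ᶠ x} {y *ᶠ x +ᶠ z *ᶠ x}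
                      {x *ᶠ y +ᶠ x *ᶠ z} (distribʳ x y z)
                      (+-cong {y *ᶠ x} {x *ᶠ y} {z *ᶠ x} {x *ᶠ z}
                        (*-comm y x) (*-comm z x))))
                , distribʳ }
    ; *-comm = *-comm } }
  where open FracLaws U

infix 8 _⁻¹[_]

_⁻¹[_] : (x : Frac U) → ¬ x ≃ 0ᶠ → Frac U
x ⁻¹[ x≄0 ] = frac (den x) (num x) λ num≋0 → x≄0
  (≋-trans (⊗-cong num≋0 ≋-refl)
    (≋-trans (⊗-zeroˡ 1ₚ) (≋-sym (⊗-zeroˡ (den x)))))

*-inverseˡ : (x : Frac U) (x≄0 : ¬ x ≃ 0ᶠ) → x ⁻¹[ x≄0 ] *ᶠ x ≃ 1ᶠ
*-inverseˡ x x≄0 = ≋-trans (⊗-comm _ 1ₚ)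
  (⊗-cong ≋-refl (⊗-comm (den x) (num x)))

∑ᶠ : ∀ {b} {A : Set b} → List A → (A → Frac U) → Frac U
∑ᶠ xs g = List.foldr (λ x acc → g x +ᶠ acc) 0ᶠ xs

syntax ∑ᶠ xs (λ x → e) = ∑[ x ∈ xs ] e

------------------------------------------------------------------------

infixr 8 _^ₚ_

_^ₚ_ : Poly U → ℕ → Poly U
p ^ₚ zero = 1ₚ
p ^ₚ suc n = p ⊗ p ^ₚ n

linear : ∀ {n} → Vec U n → Poly U
linear [] = 0ₚ
linear (u ∷ us) = var u ⊕ linear us

denominator : ∀ {k} → Vec ℕ k → Vec U k → Poly U
denominator [] [] = 1ₚ
denominator (s ∷ ss) (u ∷ us) = linear (u ∷ us) ^ₚ s ⊗ denominator ss us

linear-value : ∀ {n} (us : Vec U n) → ⟦ linear us ⟧ (λ _ → + 1) ≡ + n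
linear-value [] = refl
linear-value (u ∷ us) = cong (ℤ._+_ (+ 1)) (linear-value us)

linear-nonzero : ∀ {n} (us : Vec U (suc n)) → ¬ linear us ≋ 0ₚ
linear-nonzero us e
  with () ← trans (sym (linear-value us)) (⟦⟧-cong (λ _ → + 1) e)

^-nonzero : {p : Poly U} → ¬ p ≋ 0ₚ → ∀ n → ¬ p ^ₚ n ≋ 0ₚ
^-nonzero p≉0 zero = 1≉0
^-nonzero p≉0 (suc n) = ⊗-nonzero p≉0 (^-nonzero p≉0 n)

denominator-nonzero : ∀ {k} (ss : Vec ℕ k) (us : Vec U k) →
                      ¬ denominator ss us ≋ 0ₚ
denominator-nonzero [] [] = 1≉0
denominator-nonzero (s ∷ ss) (u ∷ us) =
  ⊗-nonzero (^-nonzero (linear-nonzero (u ∷ us)) s) (denominator-nonzero ss us)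

f : ∀ {k} → Vec ℕ k → Vec U k → Frac U
f ss us = 1/ (denominator ss us) (denominator-nonzero ss us)

------------------------------------------------------------------------

tuples : {A : Set a} → List A → (n : ℕ) → List (Vec A n)
tuples xs zero = [] ∷ []
tuples xs (suc n) = List.cartesianProductWith _∷_ xs (tuples xs n)

-- The t ∈ ℤ_{≥1}^n with |t| = N; such a t has all entries in {1,…,N}.
compositions : (n N : ℕ) → List (Vec ℕ n)
compositions n N =
  List.filter (λ t → Vec.sum t ℕ.≟ N) (tuples (List.map suc (List.upTo N)) n)

module _ {m n : ℕ} where

  OrderPreserving Injective : (Fin m → Fin n) → Set
  OrderPreserving φ = ∀ i j → i Fin.≤ j → φ i Fin.≤ φ j
  Injective φ = ∀ i j → φ i ≡ φ j → i ≡ j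

  _∈im_ : Fin n → (Fin m → Fin n) → Set
  i ∈im φ = ∃[ j ] i ≡ φ j

  orderPreserving? : ∀ φ → Dec (OrderPreserving φ)
  orderPreserving? φ =
    Fin.all? λ i → Fin.all? λ j → (i Fin.≤? j) →-dec (φ i Fin.≤? φ j)

  injective? : ∀ φ → Dec (Injective φ)
  injective? φ =
    Fin.all? λ i → Fin.all? λ j → (φ i Fin.≟ φ j) →-dec (i Fin.≟ j)

  _∈im?_ : ∀ i φ → Dec (i ∈im φ)
  i ∈im? φ = Fin.any? λ j → i Fin.≟ φ j

-- Elements of I_{k,ℓ}; positions 1,…,k+ℓ are numbered from 0.
record Shuffle (k ℓ : ℕ) : Set where
  field
    φ        : Fin k → Fin (k ℕ.+ ℓ)
    ψ        : Fin ℓ → Fin (k ℕ.+ ℓ)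
    φ-mono   : OrderPreserving φ
    φ-inj    : Injective φ
    ψ-mono   : OrderPreserving ψ
    ψ-inj    : Injective ψ
    covering : ∀ i → i ∈im φ ⊎ i ∈im ψ

shuffle? : ∀ {k ℓ} → (Fin k → Fin (k ℕ.+ ℓ)) → (Fin ℓ → Fin (k ℕ.+ ℓ)) →
           Maybe (Shuffle k ℓ)
shuffle? φ ψ = Maybe.map
  (λ (φm , φi , ψm , ψi , c) → record
    { φ = φ ; ψ = ψ ; φ-mono = φm ; φ-inj = φi
    ; ψ-mono = ψm ; ψ-inj = ψi ; covering = c })
  (dec⇒maybe (orderPreserving? φ ×-dec injective? φ ×-dec
              orderPreserving? ψ ×-dec injective? ψ ×-dec
              Fin.all? λ i → (i ∈im? φ) ⊎-dec (i ∈im? ψ)))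

shuffles : (k ℓ : ℕ) → List (Shuffle k ℓ)
shuffles k ℓ = List.mapMaybe (λ (φ , ψ) → shuffle? (lookup φ) (lookup ψ))
  (List.cartesianProduct (tuples (List.allFin (k ℕ.+ ℓ)) k)
                         (tuples (List.allFin (k ℕ.+ ℓ)) ℓ))

-- By disjointness of the images, the choice made by covering is the only
-- one possible.
_ш[_]_ : ∀ {k ℓ} {A : Set a} → Vec A k → Shuffle k ℓ → Vec A ℓ → Vec A (k ℕ.+ ℓ)
us ш[ σ ] vs = Vec.tabulate λ i →
  [ lookup us ∘ proj₁ , lookup vs ∘ proj₁ ]′ (Shuffle.covering σ i)

------------------------------------------------------------------------

binom : ℕ → ℤ → ℕ
binom n (+ m) = n C m
binom n -[1+ m ] = 0

prefixSum : ∀ {n} → Vec ℕ n → ℕ → ℕ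
prefixSum v m = ListAction.sum (List.take m (Vec.toList v))

-- |φ⁻¹({1,…,i})|
preimageCount : ∀ {m n} → (Fin m → Fin n) → Fin n → ℕ
preimageCount φ i = List.length (List.filter (λ j → φ j Fin.≤? i) (List.allFin _))

module _ {k ℓ : ℕ} (σ : Shuffle k ℓ) where
  open Shuffle σ

  -- The first case in the definition of c: i = 1, or i-1 and i both lie in
  -- im φ, or both in im ψ.
  SameSource : Fin (k ℕ.+ ℓ) → Set
  SameSource i = toℕ i ≡ 0
               ⊎ (Fin.pred i ∈im φ × i ∈im φ)
               ⊎ (Fin.pred i ∈im ψ × i ∈im ψ)

  sameSource? : ∀ i → Dec (SameSource i)
  sameSource? i = (toℕ i ℕ.≟ 0)
    ⊎-dec ((Fin.pred i ∈im? φ) ×-dec (i ∈im? φ))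
    ⊎-dec ((Fin.pred i ∈im? ψ) ×-dec (i ∈im? ψ))

  coeff : Vec ℕ k → Vec ℕ ℓ → Vec ℕ (k ℕ.+ ℓ) → Fin (k ℕ.+ ℓ) → ℕ
  coeff r s t i =
    if does (sameSource? i)
    then binom (ℕ.pred (lookup t i)) (lookup h i ⊖ 1)
    else binom (ℕ.pred (lookup t i))
           (prefixSum t (suc (toℕ i))
             ⊖ (prefixSum r (preimageCount φ i)
                ℕ.+ prefixSum s (preimageCount ψ i)))
    where h = r ш[ σ ] s

  coeffProduct : Vec ℕ k → Vec ℕ ℓ → Vec ℕ (k ℕ.+ ℓ) → ℕ
  coeffProduct r s t =
    ListAction.product (List.map (coeff r s t) (List.allFin (k ℕ.+ ℓ)))

{-# OPTIONS --safe #-}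

-- Let A, B and C be the inverses of u₁ + ⋯ + uₖ, of v₁ + ⋯ + v_ℓ and of the
-- sum of all these variables.  From A B = C (A + B) one gets, by induction
-- and Pascal's rule,
--   A^r B^s = Σ_t C^t (binom(t-1, r-1) B^(r+s-t) + binom(t-1, s-1) A^(r+s-t)).
-- Applied to the leading factors of the two fractions this splits off the
-- first letter of the shuffle, with exponent t, and leaves a product of the
-- same kind in which the leading exponent of the other word has become
-- r+s-t.  After i letters this modified exponent is R + S - T_i, where R and
-- S include the letter concerned; its binomial coefficient binom(t-1, R+S-T_i-1)
-- equals binom(t-1, T_{i+1}-R-S), the second case in the definition of c.

module Submission where

open import Defs
open import Algebra.Bundles using (CommutativeRing; CommutativeSemiring)
import Algebra.Properties.CommutativeSemigroup as CommutativeSemigroupProperties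
import Algebra.Properties.Semiring.Exp as Exp
import Algebra.Solver.Ring.NaturalCoefficients.Default as SemiringSolver
open import Data.Bool as Bool using (Bool; true; false; if_then_else_)
open import Data.Fin as Fin using (Fin; toℕ)
import Data.Fin.Properties as Fin
open import Data.Integer as ℤ using (+_; _⊖_)
import Data.Integer.Properties as ℤ
open import Data.List as List using (List; []; _∷_; _++_)
open import Data.List.Membership.Propositional using (_∈_)
open import Data.List.Membership.Propositional.Properties
open import Data.List.Membership.Propositional.Properties.WithK using (unique∧set⇒bag)
import Data.List.Properties as List
open import Data.List.Relation.Binary.BagAndSetEquality using (∼bag⇒↭)
open import Data.List.Relation.Binary.Permutation.Propositional as ↭ using (_↭_)
open import Data.List.Relation.Unary.All as ListAll using ([]; _∷_)
open import Data.List.Relation.Unary.AllPairs using ([]; _∷_)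
open import Data.List.Relation.Unary.Any using (here; there)
open import Data.List.Relation.Unary.Unique.Propositional using (Unique)
import Data.List.Relation.Unary.Unique.Propositional.Properties as Unique
open import Data.Maybe as Maybe using (Maybe; just; nothing)
open import Data.Nat as ℕ using (ℕ; zero; suc; pred; _∸_; _≤_; _<_; z≤n; s≤s)
open import Data.Nat.Combinatorics
  renaming (_C_ to _choose_)
  using (nCk≡nC[n∸k]; nCn≡1; nCk+nC[k+1]≡[n+1]C[k+1]; k>n⇒nCk≡0)
import Data.Nat.ListAction as ListAction
import Data.Nat.Properties as ℕ
open import Data.Product using (∃-syntax; _×_; _,_; proj₁; proj₂)
open import Data.Sum as Sum using (_⊎_; inj₁; inj₂; [_,_]′)
open import Data.Vec as Vec using (Vec; []; _∷_; sum; lookup)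
import Data.Vec.Properties as Vec
open import Data.Vec.Relation.Unary.All using (All; []; _∷_)
open import Function using (_∘_; id; _⇔_; mk⇔)
open import Level using (Level; _⊔_)
open import Relation.Binary.PropositionalEquality as ≡ using (_≡_; _≢_; _≗_)
import Relation.Binary.Reasoning.Setoid as SetoidReasoning
open import Relation.Nullary
  using (¬_; Dec; yes; no; does; contradiction; dec⇒maybe; _×-dec_; _⊎-dec_)
open import Relation.Nullary.Decidable using (does-⇔)
open import Relation.Unary using (Pred; Decidable)

-- The definition of `c` speaks of prefix sums of t, r and s, while the recursion knows only the
-- current modified exponents. The coefficient therefore has two forms: `weight` follows the
-- recursion, and `runWeight` carries the prefix sums along. They agree because the prefix sums
-- determine the modified exponent. As subtraction is truncated, this agreement of exponents holds
-- only where the binomial coefficients do not vanish. The relation A B = C (A + B) needs two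
-- nonempty words. Once one word is used up nothing is expanded: the binomial coefficient forces
-- each t to be at least the exponent of its letter, and the fixed total |t| then forces equality.
-- Pairs of maps do not lend themselves to recursion, and their records contain proofs. The algebra
-- therefore sums over inductive words, which are matched with the shuffles afterwards.

module +ℕ = CommutativeSemigroupProperties ℕ.+-commutativeSemigroup

-- Sums and partial fractions

range : ℕ → List ℕ
range M = List.map suc (List.upTo M)

module FiniteSum {c ℓ} (R : CommutativeSemiring c ℓ) where
  open CommutativeSemiring R hiding (zero)
  open SetoidReasoning setoid
  open CommutativeSemigroupProperties +-commutativeSemigroup
    using (interchange; x∙yz≈y∙xz)

  private
    variable
      a b p : Level
      A : Set a
      B : Set b

  ∑ : List A → (A → Carrier) → Carrier
  ∑ xs g = List.foldr (λ x acc → g x + acc) 0# xs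

  ∑-cong-∈ : ∀ (xs : List A) {g h} → (∀ {x} → x ∈ xs → g x ≈ h x) → ∑ xs g ≈ ∑ xs h
  ∑-cong-∈ [] e = refl
  ∑-cong-∈ (x ∷ xs) e = +-cong (e (here ≡.refl)) (∑-cong-∈ xs (e ∘ there))

  ∑-cong : ∀ (xs : List A) {g h} → (∀ x → g x ≈ h x) → ∑ xs g ≈ ∑ xs h
  ∑-cong xs e = ∑-cong-∈ xs (λ {x} _ → e x)

  ∑-++ : ∀ (xs ys : List A) g → ∑ (xs ++ ys) g ≈ ∑ xs g + ∑ ys g
  ∑-++ [] ys g = sym (+-identityˡ _)
  ∑-++ (x ∷ xs) ys g = trans (+-congˡ (∑-++ xs ys g)) (sym (+-assoc _ _ _))

  ∑-map : ∀ (φ : A → B) xs g → ∑ (List.map φ xs) g ≈ ∑ xs (g ∘ φ)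
  ∑-map φ [] g = refl
  ∑-map φ (x ∷ xs) g = +-congˡ (∑-map φ xs g)

  ∑-zero-∈ : ∀ (xs : List A) {g} → (∀ {x} → x ∈ xs → g x ≈ 0#) → ∑ xs g ≈ 0#
  ∑-zero-∈ [] e = refl
  ∑-zero-∈ (x ∷ xs) e =
    trans (+-cong (e (here ≡.refl)) (∑-zero-∈ xs (e ∘ there))) (+-identityˡ 0#)

  ∑-zero : ∀ (xs : List A) {g} → (∀ x → g x ≈ 0#) → ∑ xs g ≈ 0#
  ∑-zero xs e = ∑-zero-∈ xs (λ {x} _ → e x)

  ∑-+ : ∀ (xs : List A) g h → ∑ xs g + ∑ xs h ≈ ∑ xs (λ x → g x + h x)
  ∑-+ [] g h = +-identityˡ 0#
  ∑-+ (x ∷ xs) g h = trans (interchange _ _ _ _) (+-congˡ (∑-+ xs g h))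

  *-∑ : ∀ (xs : List A) y g → y * ∑ xs g ≈ ∑ xs (λ x → y * g x)
  *-∑ [] y g = zeroʳ y
  *-∑ (x ∷ xs) y g = trans (distribˡ y _ _) (+-congˡ (*-∑ xs y g))

  ∑-* : ∀ (xs : List A) y g → ∑ xs g * y ≈ ∑ xs (λ x → g x * y)
  ∑-* xs y g =
    trans (*-comm _ y) (trans (*-∑ xs y g) (∑-cong xs (λ x → *-comm y (g x))))

  ∑-swap : ∀ (xs : List A) (ys : List B) (g : A → B → Carrier) →
           ∑ xs (λ x → ∑ ys (g x)) ≈ ∑ ys (λ y → ∑ xs (λ x → g x y))
  ∑-swap [] ys g = sym (∑-zero ys (λ _ → refl))
  ∑-swap (x ∷ xs) ys g = trans (+-congˡ (∑-swap xs ys g)) (∑-+ ys _ _)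

  ∑-filter-map : ∀ {P : Pred B p} (P? : Decidable P) (φ : A → B) xs g →
                 ∑ (List.filter P? (List.map φ xs)) g
                   ≈ ∑ (List.filter (P? ∘ φ) xs) (g ∘ φ)
  ∑-filter-map P? φ [] g = refl
  ∑-filter-map P? φ (x ∷ xs) g with does (P? (φ x))
  ... | true = +-congˡ (∑-filter-map P? φ xs g)
  ... | false = ∑-filter-map P? φ xs g

  -- Tuples are products under `_∷_`, so this opens a sum over compositions into a sum over first
  -- entries and a sum over the tails that meet the remaining condition.
  ∑-filter-cartesianProductWith :
    ∀ {d} {D : Set d} {P : Pred D p} (P? : Decidable P) (φ : A → B → D) xs ys g →
    ∑ (List.filter P? (List.cartesianProductWith φ xs ys)) g
      ≈ ∑ xs (λ x → ∑ (List.filter (P? ∘ φ x) ys) (g ∘ φ x))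
  ∑-filter-cartesianProductWith P? φ [] ys g = refl
  ∑-filter-cartesianProductWith P? φ (x ∷ xs) ys g = begin
    ∑ (List.filter P? (List.map (φ x) ys ++ rest)) g
      ≡⟨ ≡.cong (λ zs → ∑ zs g) (List.filter-++ P? (List.map (φ x) ys) rest) ⟩
    ∑ (List.filter P? (List.map (φ x) ys) ++ List.filter P? rest) g
      ≈⟨ ∑-++ (List.filter P? (List.map (φ x) ys)) (List.filter P? rest) g ⟩
    ∑ (List.filter P? (List.map (φ x) ys)) g + ∑ (List.filter P? rest) g
      ≈⟨ +-cong (∑-filter-map P? (φ x) ys g)
                (∑-filter-cartesianProductWith P? φ xs ys g) ⟩
    ∑ (List.filter (P? ∘ φ x) ys) (g ∘ φ x)
      + ∑ xs (λ x → ∑ (List.filter (P? ∘ φ x) ys) (g ∘ φ x)) ∎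
    where rest = List.cartesianProductWith φ xs ys

  ∑-↭ : ∀ {xs ys : List A} g → xs ↭ ys → ∑ xs g ≈ ∑ ys g
  ∑-↭ g ↭.refl = refl
  ∑-↭ g (↭.prep x p) = +-congˡ (∑-↭ g p)
  ∑-↭ g (↭.swap x y p) =
    trans (+-congˡ (+-congˡ (∑-↭ g p))) (x∙yz≈y∙xz (g x) (g y) _)
  ∑-↭ g (↭.trans p q) = trans (∑-↭ g p) (∑-↭ g q)

  ∑-single : ∀ {xs : List A} {x} g → Unique xs → x ∈ xs →
             (∀ {y} → y ∈ xs → y ≢ x → g y ≈ 0#) → ∑ xs g ≈ g x
  ∑-single {xs = x ∷ xs} g (x∉ ∷ _) (here ≡.refl) e =
    trans (+-congˡ (∑-zero-∈ xs (λ y∈ → e (there y∈) (ListAll.lookup x∉ y∈ ∘ ≡.sym))))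
      (+-identityʳ (g x))
  ∑-single {xs = y ∷ xs} g (y∉ ∷ u) (there x∈) e =
    trans (+-cong (e (here ≡.refl) (ListAll.lookup y∉ x∈)) (∑-single g u x∈ (e ∘ there)))
      (+-identityˡ _)

  ∑-upTo-suc : ∀ n g → ∑ (List.upTo (suc n)) g ≈ g 0 + ∑ (List.upTo n) (g ∘ suc)
  ∑-upTo-suc n g = +-congˡ (trans
    (reflexive (≡.cong (λ zs → ∑ zs g) (≡.sym (List.map-upTo suc n))))
    (∑-map suc (List.upTo n) g))

-- The homomorphism is data, so that in ℤ(U) it can be `fromℕ`, which carries the coefficients of
-- the theorem, instead of repeated addition of 1.
record ℕEmbedding {c ℓ} (R : CommutativeSemiring c ℓ) : Set (c ⊔ ℓ) where
  open CommutativeSemiring R hiding (zero)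
  field
    ι    : ℕ → Carrier
    ι-0  : ι 0 ≈ 0#
    ι-1  : ι 1 ≈ 1#
    ι-+  : ∀ m n → ι (m ℕ.+ n) ≈ ι m + ι n
    ι-*  : ∀ m n → ι (m ℕ.* n) ≈ ι m * ι n

module PartialFractions {c ℓ} (R : CommutativeSemiring c ℓ) (E : ℕEmbedding R) where
  open CommutativeSemiring R hiding (zero)
  open ℕEmbedding E
  open FiniteSum R
  open Exp semiring using (_^_)
  open SemiringSolver R
  open SetoidReasoning setoid

  -- x ^⁺ 0 = 0 discards the terms of expansion with t ≥ r + s, whose exponent
  -- of B is truncated to 0.
  infixr 8 _^⁺_

  _^⁺_ : Carrier → ℕ → Carrier
  x ^⁺ zero = 0#
  x ^⁺ suc m = x ^ suc m

  ι0* : ∀ {m} x → m ≡ 0 → ι m * x ≈ 0#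
  ι0* x ≡.refl = trans (*-congʳ ι-0) (zeroˡ x)

  -- The half of the partial fraction sum for `A ^ r * B ^ s` whose terms keep powers of `B`; the
  -- index t stands for the exponent `suc t` of `C`. For r = 0, binom(t-1, -1) is read as 1 at
  -- exponent t = 0 and as 0 elsewhere, which leaves `B ^ s`.
  expansion : ℕ → Carrier → Carrier → ℕ → ℕ → Carrier
  expansion M C B zero s = B ^ s
  expansion M C B (suc r) s =
    ∑ (List.upTo M) (λ t → ι (t choose r) * (C ^ suc t * B ^⁺ (r ℕ.+ s ∸ t)))

  -- `t choose r` vanishes for t < r, and for t ≥ r the exponent of `B` is truncated to 0.
  expansion-0 : ∀ M C B r → expansion M C B (suc r) 0 ≈ 0#
  expansion-0 M C B r = ∑-zero (List.upTo M) term
    where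
    term : ∀ t → _
    term t with t ℕ.<? r
    ... | yes t<r = ι0* _ (k>n⇒nCk≡0 t<r)
    ... | no t≮r = trans (*-congˡ (*-congˡ (reflexive (≡.cong (B ^⁺_)
      (≡.trans (≡.cong (_∸ t) (ℕ.+-identityʳ r)) (ℕ.m≤n⇒m∸n≡0 (ℕ.≮⇒≥ t≮r)))))))
      (trans (*-congˡ (zeroʳ _)) (zeroʳ _))

  -- Pascal's rule after a shift of t by one, which accounts for the factor `C` and for the unit by
  -- which `M` drops. The unshifted term t = 0 survives for r = 0 alone, where it supplies the
  -- separate clause `B ^ suc s`.
  expansion-suc : ∀ M C B r s → expansion (suc M) C B (suc r) (suc s)
                    ≈ C * (expansion M C B r (suc s) + expansion M C B (suc r) s)
  expansion-suc M C B zero s = begin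
    expansion (suc M) C B 1 (suc s)
      ≈⟨ ∑-upTo-suc M _ ⟩
    ι 1 * (C ^ 1 * B ^ suc s)
      + ∑ (List.upTo M) (λ t → ι 1 * (C ^ suc (suc t) * B ^⁺ (s ∸ t)))
      ≈⟨ +-cong
           (trans (*-congʳ ι-1) (solve 2 (λ c x → con 1 :* ((c :* con 1) :* x) := c :* x)
             refl C (B ^ suc s)))
           (trans (∑-cong (List.upTo M) (λ t →
             solve 4 (λ i c x y → i :* ((c :* x) :* y) := c :* (i :* (x :* y)))
               refl (ι 1) C (C ^ suc t) (B ^⁺ (s ∸ t))))
             (sym (*-∑ (List.upTo M) C _))) ⟩
    C * B ^ suc s + C * expansion M C B 1 s
      ≈⟨ distribˡ C _ _ ⟨
    C * (B ^ suc s + expansion M C B 1 s) ∎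
  expansion-suc M C B (suc r) s = begin
    expansion (suc M) C B (suc (suc r)) (suc s)
      ≈⟨ ∑-upTo-suc M _ ⟩
    ι 0 * (C ^ 1 * B ^⁺ (suc r ℕ.+ suc s))
      + ∑ (List.upTo M) (λ t →
          ι (suc t choose suc r) * (C ^ suc (suc t) * B ^⁺ (r ℕ.+ suc s ∸ t)))
      ≈⟨ +-cong (ι0* _ ≡.refl) (∑-cong (List.upTo M) pascal) ⟩
    0# + ∑ (List.upTo M) (λ t → C * (g t + h t))
      ≈⟨ +-identityˡ _ ⟩
    ∑ (List.upTo M) (λ t → C * (g t + h t))
      ≈⟨ trans (*-congˡ (∑-+ (List.upTo M) g h)) (*-∑ (List.upTo M) C _) ⟨
    C * (expansion M C B (suc r) (suc s) + expansion M C B (suc (suc r)) s) ∎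
    where
    g h : ℕ → Carrier
    g t = ι (t choose r) * (C ^ suc t * B ^⁺ (r ℕ.+ suc s ∸ t))
    h t = ι (t choose suc r) * (C ^ suc t * B ^⁺ (suc r ℕ.+ s ∸ t))
    pascal : ∀ t → ι (suc t choose suc r) * (C ^ suc (suc t) * B ^⁺ (r ℕ.+ suc s ∸ t))
                   ≈ C * (g t + h t)
    pascal t rewrite ≡.sym (ℕ.+-suc r s) = trans
      (*-congʳ (trans (reflexive (≡.cong ι (≡.sym (nCk+nC[k+1]≡[n+1]C[k+1] t r))))
        (ι-+ (t choose r) (t choose suc r))))
      (solve 5 (λ i j c x y → (i :+ j) :* ((c :* x) :* y)
                           := c :* (i :* (x :* y) :+ j :* (x :* y)))
        refl (ι (t choose r)) (ι (t choose suc r)) C (C ^ suc t)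
        (B ^⁺ (r ℕ.+ suc s ∸ t)))

  -- Induction on `M`: one use of the relation lowers r + s by one in both summands. `M` may exceed
  -- r + s - 1, so that one range of summation serves all stages of the expansion. For r = s = 0 the
  -- right side would be 1 + 1.
  partialFractions : ∀ {A B C} → A * B ≈ C * (A + B) → ∀ M r s →
    1 ≤ r ℕ.+ s → r ℕ.+ s ≤ suc M →
    A ^ r * B ^ s ≈ expansion M C B r s + expansion M C A s r
  partialFractions {A} {B} {C} e M zero (suc s) _ _ = begin
    1# * B ^ suc s  ≈⟨ *-identityˡ _ ⟩
    B ^ suc s       ≈⟨ +-identityʳ _ ⟨
    B ^ suc s + 0#  ≈⟨ +-congˡ (expansion-0 M C A s) ⟨
    B ^ suc s + expansion M C A (suc s) 0 ∎
  partialFractions {A} {B} {C} e M (suc r) zero _ _ = begin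
    A ^ suc r * 1#  ≈⟨ *-identityʳ _ ⟩
    A ^ suc r       ≈⟨ +-identityˡ _ ⟨
    0# + A ^ suc r  ≈⟨ +-congʳ (expansion-0 M C B r) ⟨
    expansion M C B (suc r) 0 + A ^ suc r ∎
  partialFractions e zero (suc r) (suc s) _ (s≤s le)
    with () ← ≡.trans (≡.sym (ℕ.+-suc r s)) (ℕ.n≤0⇒n≡0 le)
  partialFractions {A} {B} {C} e (suc M) (suc r) (suc s) _ (s≤s le) = begin
    (A * A ^ r) * (B * B ^ s)
      ≈⟨ solve 4 (λ a x b y → (a :* x) :* (b :* y) := (a :* b) :* (x :* y))
           refl A (A ^ r) B (B ^ s) ⟩
    (A * B) * (A ^ r * B ^ s)
      ≈⟨ *-congʳ e ⟩
    (C * (A + B)) * (A ^ r * B ^ s)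
      ≈⟨ solve 5 (λ a x b y c → (c :* (a :+ b)) :* (x :* y)
                             := c :* (x :* (b :* y) :+ (a :* x) :* y))
           refl A (A ^ r) B (B ^ s) C ⟩
    C * (A ^ r * B ^ suc s + A ^ suc r * B ^ s)
      ≈⟨ *-congˡ (+-cong
           (partialFractions e M r (suc s) (ℕ.m≤n⇒m≤o+n r (s≤s z≤n)) le)
           (partialFractions e M (suc r) s (s≤s z≤n)
             (ℕ.≤-trans (ℕ.≤-reflexive (≡.sym (ℕ.+-suc r s))) le))) ⟩
    C * ((expansion M C B r (suc s) + expansion M C A (suc s) r)
       + (expansion M C B (suc r) s + expansion M C A s (suc r)))
      ≈⟨ solve 5 (λ c x y z w → c :* ((x :+ y) :+ (z :+ w))
                             := c :* (x :+ z) :+ c :* (w :+ y))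
           refl C _ _ _ _ ⟩
    C * (expansion M C B r (suc s) + expansion M C B (suc r) s)
      + C * (expansion M C A s (suc r) + expansion M C A (suc s) r)
      ≈⟨ +-cong (expansion-suc M C B r s) (expansion-suc M C A s r) ⟨
    expansion (suc M) C B (suc r) (suc s) + expansion (suc M) C A (suc s) (suc r) ∎

-- Words and their weights

module _ where

  open ≡ using (refl; sym; trans; cong; cong₂)
  open import Data.Fin using (zero; suc)

  infixr 5 l∷_ r∷_

  -- The length is an index of its own, since `k + suc ℓ` does not reduce to `suc (k + ℓ)`.
  data Word : ℕ → ℕ → ℕ → Set where
    []  : Word 0 0 0
    l∷_ : ∀ {k ℓ n} → Word k ℓ n → Word (suc k) ℓ (suc n)
    r∷_ : ∀ {k ℓ n} → Word k ℓ n → Word k (suc ℓ) (suc n)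

  words : ∀ k ℓ n → List (Word k ℓ n)
  words-l words-r : ∀ k ℓ n → List (Word k ℓ (suc n))

  words zero zero zero = [] ∷ []
  words zero (suc ℓ) zero = []
  words (suc k) ℓ zero = []
  words k ℓ (suc n) = words-l k ℓ n ++ words-r k ℓ n

  words-l zero ℓ n = []
  words-l (suc k) ℓ n = List.map l∷_ (words k ℓ n)

  words-r k zero n = []
  words-r k (suc ℓ) n = List.map r∷_ (words k ℓ n)

  merge : ∀ {a} {A : Set a} {k ℓ n} → Word k ℓ n → Vec A k → Vec A ℓ → Vec A n
  merge [] [] [] = []
  merge (l∷ w) (x ∷ xs) ys = x ∷ merge w xs ys
  merge (r∷ w) xs (y ∷ ys) = y ∷ merge w xs ys

  -- If a letter of exponent x is written with exponent t, the remaining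
  -- x + y - t is left to the first letter of the other word.  Where the
  -- subtraction is truncated, weight is zero, because binom n (0 ⊖ 1) = 0.
  carry : ∀ {n} → ℕ → ℕ → Vec ℕ n → Vec ℕ n
  carry x t [] = []
  carry x t (y ∷ s) = (x ℕ.+ y ∸ t) ∷ s

  -- The coefficient as the recursion produces it. With modified exponents there is one kind of
  -- factor, whether or not the source has just changed.
  weight : ∀ {k ℓ n} → Word k ℓ n → Vec ℕ k → Vec ℕ ℓ → Vec ℕ n → ℕ
  weight [] [] [] [] = 1
  weight (l∷ w) (x ∷ r) s (t ∷ ts) =
    binom (pred t) (x ⊖ 1) ℕ.* weight w r (carry x t s) ts
  weight (r∷ w) r (y ∷ s) (t ∷ ts) =
    binom (pred t) (y ⊖ 1) ℕ.* weight w (carry y t r) s ts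

  binom-< : ∀ {t x} → 1 ≤ t → t < x → binom (pred t) (x ⊖ 1) ≡ 0
  binom-< {suc t} {suc x} _ (s≤s t<x) = k>n⇒nCk≡0 t<x

  binom≢0⊎≤ : ∀ {t} x → 1 ≤ t → binom (pred t) (x ⊖ 1) ≡ 0 ⊎ x ≤ t
  binom≢0⊎≤ {t} x 1≤t with x ℕ.≤? t
  ... | yes x≤t = inj₂ x≤t
  ... | no x≰t = inj₁ (binom-< 1≤t (ℕ.≰⇒> x≰t))

  Positive : ∀ {n} → Vec ℕ n → Set
  Positive = All (1 ≤_)

  m*≡0 : ∀ m {n} → n ≡ 0 → m ℕ.* n ≡ 0
  m*≡0 m refl = ℕ.*-zeroʳ m

  -- A zero exponent stays zero while it waits: a letter y of the other word has a nonzero binomial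
  -- only for y ≤ t, and then `y + 0 ∸ t` is 0. When the zero is finally written, its binomial has
  -- lower index -1.
  weight-zero-l : ∀ {k ℓ n} (w : Word (suc k) ℓ n) r s {t} → Positive t →
                  weight w (0 ∷ r) s t ≡ 0
  weight-zero-l (l∷ w) r s (_ ∷ _) = refl
  weight-zero-l (r∷ w) r (y ∷ s) {t ∷ ts} (1≤t ∷ p) with binom≢0⊎≤ y 1≤t
  ... | inj₁ e = cong (ℕ._* weight w ((y ℕ.+ 0 ∸ t) ∷ r) s ts) e
  ... | inj₂ y≤t
    rewrite ℕ.m≤n⇒m∸n≡0 (ℕ.≤-trans (ℕ.≤-reflexive (ℕ.+-identityʳ y)) y≤t) =
    m*≡0 (binom (pred t) (y ⊖ 1)) (weight-zero-l w r s p)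

  weight-zero-r : ∀ {k ℓ n} (w : Word k (suc ℓ) n) r s {t} → Positive t →
                  weight w r (0 ∷ s) t ≡ 0
  weight-zero-r (r∷ w) r s (_ ∷ _) = refl
  weight-zero-r (l∷ w) (x ∷ r) s {t ∷ ts} (1≤t ∷ p) with binom≢0⊎≤ x 1≤t
  ... | inj₁ e = cong (ℕ._* weight w r ((x ℕ.+ 0 ∸ t) ∷ s) ts) e
  ... | inj₂ x≤t
    rewrite ℕ.m≤n⇒m∸n≡0 (ℕ.≤-trans (ℕ.≤-reflexive (ℕ.+-identityʳ x)) x≤t) =
    m*≡0 (binom (pred t) (x ⊖ 1)) (weight-zero-r w r s p)

  carry-sum : ∀ {n x t} → x ≤ t → (s : Vec ℕ n) → x ℕ.+ sum s ≤ t ℕ.+ sum (carry x t s)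
  carry-sum x≤t [] = ℕ.+-monoˡ-≤ 0 x≤t
  carry-sum {x = x} {t} x≤t (y ∷ s) = begin
    x ℕ.+ (y ℕ.+ sum s)                ≡⟨ ℕ.+-assoc x y (sum s) ⟨
    x ℕ.+ y ℕ.+ sum s                  ≤⟨ ℕ.+-monoˡ-≤ (sum s) (ℕ.m≤n+m∸n (x ℕ.+ y) t) ⟩
    t ℕ.+ (x ℕ.+ y ∸ t) ℕ.+ sum s      ≡⟨ ℕ.+-assoc t _ (sum s) ⟩
    t ℕ.+ (x ℕ.+ y ∸ t ℕ.+ sum s)      ∎
    where open ℕ.≤-Reasoning

  -- Where the binomial of a letter x does not vanish, x ≤ t, and by `carry-sum` writing that letter
  -- does not lower the written exponents plus those still to come. This bound excludes all but one
  -- t once a word is exhausted.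
  weight-support : ∀ {k ℓ n} (w : Word k ℓ n) r s {t} → Positive t →
                   weight w r s t ≡ 0 ⊎ sum r ℕ.+ sum s ≤ sum t
  weight-support [] [] [] [] = inj₂ z≤n
  weight-support (l∷ w) (x ∷ r) s {t ∷ ts} (1≤t ∷ p)
    with binom≢0⊎≤ x 1≤t | weight-support w r (carry x t s) p
  ... | inj₁ e | _ = inj₁ (cong (ℕ._* weight w r (carry x t s) ts) e)
  ... | inj₂ _ | inj₁ e = inj₁ (m*≡0 (binom (pred t) (x ⊖ 1)) e)
  ... | inj₂ x≤t | inj₂ le = inj₂ (begin
    x ℕ.+ sum r ℕ.+ sum s                    ≡⟨ cong (ℕ._+ sum s) (ℕ.+-comm x (sum r)) ⟩
    sum r ℕ.+ x ℕ.+ sum s                    ≡⟨ ℕ.+-assoc (sum r) x (sum s) ⟩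
    sum r ℕ.+ (x ℕ.+ sum s)                  ≤⟨ ℕ.+-monoʳ-≤ (sum r) (carry-sum x≤t s) ⟩
    sum r ℕ.+ (t ℕ.+ sum (carry x t s))      ≡⟨ +ℕ.x∙yz≈y∙xz (sum r) t _ ⟩
    t ℕ.+ (sum r ℕ.+ sum (carry x t s))      ≤⟨ ℕ.+-monoʳ-≤ t le ⟩
    t ℕ.+ sum ts                             ∎)
    where
    open ℕ.≤-Reasoning
  weight-support (r∷ w) r (y ∷ s) {t ∷ ts} (1≤t ∷ p)
    with binom≢0⊎≤ y 1≤t | weight-support w (carry y t r) s p
  ... | inj₁ e | _ = inj₁ (cong (ℕ._* weight w (carry y t r) s ts) e)
  ... | inj₂ _ | inj₁ e = inj₁ (m*≡0 (binom (pred t) (y ⊖ 1)) e)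
  ... | inj₂ y≤t | inj₂ le = inj₂ (begin
    sum r ℕ.+ (y ℕ.+ sum s)                  ≡⟨ +ℕ.x∙yz≈y∙xz (sum r) y (sum s) ⟩
    y ℕ.+ (sum r ℕ.+ sum s)                  ≡⟨ ℕ.+-assoc y (sum r) (sum s) ⟨
    y ℕ.+ sum r ℕ.+ sum s                    ≤⟨ ℕ.+-monoˡ-≤ (sum s) (carry-sum y≤t r) ⟩
    t ℕ.+ sum (carry y t r) ℕ.+ sum s        ≡⟨ ℕ.+-assoc t _ (sum s) ⟩
    t ℕ.+ (sum (carry y t r) ℕ.+ sum s)      ≤⟨ ℕ.+-monoʳ-≤ t le ⟩
    t ℕ.+ sum ts                             ∎)
    where
    open ℕ.≤-Reasoning

  -- Positions and sources in a word; weights in terms of prefix sums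

  posˡ : ∀ {k ℓ n} → Word k ℓ n → Fin k → Fin n
  posˡ (l∷ w) zero = zero
  posˡ (l∷ w) (suc j) = suc (posˡ w j)
  posˡ (r∷ w) j = suc (posˡ w j)

  posʳ : ∀ {k ℓ n} → Word k ℓ n → Fin ℓ → Fin n
  posʳ (r∷ w) zero = zero
  posʳ (r∷ w) (suc j) = suc (posʳ w j)
  posʳ (l∷ w) j = suc (posʳ w j)

  isˡ : ∀ {k ℓ n} → Word k ℓ n → Fin n → Bool
  isˡ (l∷ w) zero = true
  isˡ (r∷ w) zero = false
  isˡ (l∷ w) (suc i) = isˡ w i
  isˡ (r∷ w) (suc i) = isˡ w i

  prevIsˡ : ∀ {k ℓ n} → Bool → Word k ℓ n → Fin n → Bool
  prevIsˡ b w zero = b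
  prevIsˡ b (l∷ w) (suc i) = prevIsˡ true w i
  prevIsˡ b (r∷ w) (suc i) = prevIsˡ false w i

  -- Placing an imaginary letter of the same source before the first one puts i = 1 into the first
  -- case of `c`. The value at `[]` is arbitrary.
  headIsˡ : ∀ {k ℓ n} → Word k ℓ n → Bool
  headIsˡ [] = true
  headIsˡ (l∷ w) = true
  headIsˡ (r∷ w) = false

  countˡ : ∀ {k ℓ n} → Word k ℓ n → Fin n → ℕ
  countˡ (l∷ w) zero = 1
  countˡ (l∷ w) (suc i) = suc (countˡ w i)
  countˡ (r∷ w) zero = 0
  countˡ (r∷ w) (suc i) = countˡ w i

  countʳ : ∀ {k ℓ n} → Word k ℓ n → Fin n → ℕ
  countʳ (r∷ w) zero = 1
  countʳ (r∷ w) (suc i) = suc (countʳ w i)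
  countʳ (l∷ w) zero = 0
  countʳ (l∷ w) (suc i) = countʳ w i

  -- b tells the source of the letter before w; A and B are the sums of the
  -- exponents t_i, respectively r_i and s_i, over the letters before w.
  runWeight : ∀ {k ℓ n} → Bool → ℕ → ℕ → Word k ℓ n →
              Vec ℕ k → Vec ℕ ℓ → Vec ℕ n → ℕ
  runWeight b A B [] [] [] [] = 1
  runWeight b A B (l∷ w) (x ∷ r) s (t ∷ ts) =
    (if does (b Bool.≟ true) then binom (pred t) (x ⊖ 1)
                             else binom (pred t) ((A ℕ.+ t) ⊖ (B ℕ.+ x)))
    ℕ.* runWeight true (A ℕ.+ t) (B ℕ.+ x) w r s ts
  runWeight b A B (r∷ w) r (y ∷ s) (t ∷ ts) =
    (if does (b Bool.≟ false) then binom (pred t) (y ⊖ 1)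
                              else binom (pred t) ((A ℕ.+ t) ⊖ (B ℕ.+ y)))
    ℕ.* runWeight false (A ℕ.+ t) (B ℕ.+ y) w r s ts

  -- For m > A this is the symmetry of binomial coefficients, the two lower indices adding up to t -
  -- 1; if one of them exceeds t - 1, the other is negative. For m ≤ A the left index is at least t,
  -- and the right one is -1 by truncation.
  binom-⊖ : ∀ A m {t} → 1 ≤ t →
            binom (pred t) ((A ℕ.+ t) ⊖ m) ≡ binom (pred t) ((m ∸ A) ⊖ 1)
  binom-⊖ A m {suc t} _ with m ℕ.≤? A
  ... | yes m≤A rewrite ℕ.m≤n⇒m∸n≡0 m≤A | ℤ.⊖-≥ (ℕ.≤-trans m≤A (ℕ.m≤m+n A (suc t))) =
    k>n⇒nCk≡0 (ℕ.m+n≤o⇒m≤o∸n (suc t) (ℕ.≤-trans (ℕ.+-monoʳ-≤ (suc t) m≤A)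
      (ℕ.≤-reflexive (ℕ.+-comm (suc t) A))))
  ... | no m≰A with m ∸ A | ℕ.m+[n∸m]≡n (ℕ.<⇒≤ (ℕ.≰⇒> m≰A))
  ...   | zero | refl = contradiction (ℕ.≤-reflexive (ℕ.+-identityʳ A)) m≰A
  ...   | suc d | refl rewrite ℤ.+-cancelˡ-⊖ A (suc t) (suc d) | ℤ.[1+m]⊖[1+n]≡m⊖n t d
    with d ℕ.≤? t
  ...     | yes d≤t rewrite ℤ.⊖-≥ d≤t = sym (nCk≡nC[n∸k] d≤t)
  ...     | no d≰t rewrite ℤ.⊖-< (ℕ.≰⇒> d≰t) with d ∸ t | ℕ.m<n⇒0<n∸m (ℕ.≰⇒> d≰t)
  ...       | suc _ | _ = sym (k>n⇒nCk≡0 (ℕ.≰⇒> d≰t))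

  carry-shift : ∀ {A B} x y t → A ≤ B ℕ.+ y →
                B ℕ.+ x ℕ.+ y ∸ (A ℕ.+ t) ≡ x ℕ.+ (B ℕ.+ y ∸ A) ∸ t
  carry-shift {A} {B} x y t le = begin
    B ℕ.+ x ℕ.+ y ∸ (A ℕ.+ t)      ≡⟨ ℕ.∸-+-assoc (B ℕ.+ x ℕ.+ y) A t ⟨
    B ℕ.+ x ℕ.+ y ∸ A ∸ t          ≡⟨ cong (λ m → m ∸ A ∸ t) (trans (ℕ.+-assoc B x y)
                                        (+ℕ.x∙yz≈y∙xz B x y)) ⟩
    x ℕ.+ (B ℕ.+ y) ∸ A ∸ t        ≡⟨ cong (_∸ t) (ℕ.+-∸-assoc x le) ⟩
    x ℕ.+ (B ℕ.+ y ∸ A) ∸ t        ∎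
    where open ≡.≡-Reasoning

  -- If A exceeds B + y, both truncated differences vanish.
  carry-skip : ∀ A B x y {t} → 1 ≤ t → binom (pred t) (x ⊖ 1) ≡ 0
               ⊎ B ℕ.+ x ℕ.+ y ∸ (A ℕ.+ t) ≡ x ℕ.+ (B ℕ.+ y ∸ A) ∸ t
  carry-skip A B x y {t} 1≤t with A ℕ.≤? B ℕ.+ y
  ... | yes le = inj₂ (carry-shift x y t le)
  ... | no ≰ with binom≢0⊎≤ x 1≤t
  ...   | inj₁ e = inj₁ e
  ...   | inj₂ x≤t = inj₂ (begin
    B ℕ.+ x ℕ.+ y ∸ (A ℕ.+ t)  ≡⟨ ℕ.m≤n⇒m∸n≡0 (ℕ.≤-trans
                                    (ℕ.≤-reflexive (+ℕ.xy∙z≈xz∙y B x y))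
                                    (ℕ.+-mono-≤ B+y≤A x≤t)) ⟩
    0                          ≡⟨ ℕ.m≤n⇒m∸n≡0 (ℕ.≤-trans
                                    (ℕ.≤-reflexive (ℕ.+-identityʳ x)) x≤t) ⟨
    x ℕ.+ 0 ∸ t                ≡⟨ cong (λ m → x ℕ.+ m ∸ t) (ℕ.m≤n⇒m∸n≡0 B+y≤A) ⟨
    x ℕ.+ (B ℕ.+ y ∸ A) ∸ t    ∎)
    where
    open ≡.≡-Reasoning
    B+y≤A = ℕ.<⇒≤ (ℕ.≰⇒> ≰)

  carry-switch : ∀ A B x y {t} → 1 ≤ t → binom (pred t) ((B ℕ.+ y ∸ A) ⊖ 1) ≡ 0
                 ⊎ B ℕ.+ y ℕ.+ x ∸ (A ℕ.+ t) ≡ (B ℕ.+ y ∸ A) ℕ.+ x ∸ t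
  carry-switch A B x y {t} 1≤t with A ℕ.≤? B ℕ.+ y
  ... | yes le = inj₂ (trans (cong (_∸ (A ℕ.+ t)) (+ℕ.xy∙z≈xz∙y B y x))
    (trans (carry-shift x y t le) (cong (_∸ t) (ℕ.+-comm x _))))
  ... | no ≰ rewrite ℕ.m≤n⇒m∸n≡0 (ℕ.<⇒≤ (ℕ.≰⇒> ≰)) = inj₁ refl

  -- The remaining weights need to agree only where the leading binomial is nonzero; elsewhere
  -- truncation may have spoilt the exponents.
  *-cong-≢0 : ∀ {c c′ m m′} → c ≡ c′ → c′ ≡ 0 ⊎ m ≡ m′ → c ℕ.* m ≡ c′ ℕ.* m′
  *-cong-≢0 {m = m} {m′} refl (inj₁ refl) = refl
  *-cong-≢0 refl (inj₂ refl) = refl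

  -- With one word exhausted the source no longer changes, and the accumulators are never consulted.
  runWeight-[]ʳ : ∀ {k n} A B (w : Word k 0 n) r t →
                  runWeight true A B w r [] t ≡ weight w r [] t
  runWeight-[]ʳ A B [] [] [] = refl
  runWeight-[]ʳ A B (l∷ w) (x ∷ r) (t ∷ ts) =
    cong (binom (pred t) (x ⊖ 1) ℕ.*_) (runWeight-[]ʳ (A ℕ.+ t) (B ℕ.+ x) w r ts)

  runWeight-[]ˡ : ∀ {ℓ n} A B (w : Word 0 ℓ n) s t →
                  runWeight false A B w [] s t ≡ weight w [] s t
  runWeight-[]ˡ A B [] [] [] = refl
  runWeight-[]ˡ A B (r∷ w) (x ∷ s) (t ∷ ts) =
    cong (binom (pred t) (x ⊖ 1) ℕ.*_) (runWeight-[]ˡ (A ℕ.+ t) (B ℕ.+ x) w s ts)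

  -- The invariant after a letter of the left word: the head `y` of the right word waits with
  -- modified exponent `B + y ∸ A`, while the left word has its original exponents. Another left
  -- letter preserves this by `carry-skip`; a right letter exchanges the roles by `carry-switch`.
  runWeight-l : ∀ {k ℓ n} A B (w : Word k (suc ℓ) n) r y s {t} → Positive t →
                runWeight true A B w r (y ∷ s) t ≡ weight w r ((B ℕ.+ y ∸ A) ∷ s) t
  runWeight-r : ∀ {k ℓ n} A B (w : Word (suc k) ℓ n) x r s {t} → Positive t →
                runWeight false A B w (x ∷ r) s t ≡ weight w ((B ℕ.+ x ∸ A) ∷ r) s t

  runWeight-l A B (l∷ w) (x ∷ r) y s {t ∷ ts} (1≤t ∷ p) =
    *-cong-≢0 refl (Sum.map₂
      (λ e → trans (runWeight-l (A ℕ.+ t) (B ℕ.+ x) w r y s p)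
        (cong (λ d → weight w r (d ∷ s) ts) e))
      (carry-skip A B x y 1≤t))
  runWeight-l A B (r∷ w) [] y s {t ∷ ts} (1≤t ∷ p) =
    cong₂ ℕ._*_ (binom-⊖ A (B ℕ.+ y) 1≤t)
      (runWeight-[]ˡ (A ℕ.+ t) (B ℕ.+ y) w s ts)
  runWeight-l A B (r∷ w) (x ∷ r) y s {t ∷ ts} (1≤t ∷ p) =
    *-cong-≢0 (binom-⊖ A (B ℕ.+ y) 1≤t) (Sum.map₂
      (λ e → trans (runWeight-r (A ℕ.+ t) (B ℕ.+ y) w x r s p)
        (cong (λ d → weight w (d ∷ r) s ts) e))
      (carry-switch A B x y 1≤t))

  runWeight-r A B (r∷ w) x r (y ∷ s) {t ∷ ts} (1≤t ∷ p) =
    *-cong-≢0 refl (Sum.map₂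
      (λ e → trans (runWeight-r (A ℕ.+ t) (B ℕ.+ y) w x r s p)
        (cong (λ d → weight w (d ∷ r) s ts) e))
      (carry-skip A B y x 1≤t))
  runWeight-r A B (l∷ w) x r [] {t ∷ ts} (1≤t ∷ p) =
    cong₂ ℕ._*_ (binom-⊖ A (B ℕ.+ x) 1≤t)
      (runWeight-[]ʳ (A ℕ.+ t) (B ℕ.+ x) w r ts)
  runWeight-r A B (l∷ w) x r (y ∷ s) {t ∷ ts} (1≤t ∷ p) =
    *-cong-≢0 (binom-⊖ A (B ℕ.+ x) 1≤t) (Sum.map₂
      (λ e → trans (runWeight-l (A ℕ.+ t) (B ℕ.+ x) w r y s p)
        (cong (λ d → weight w r (d ∷ s) ts) e))
      (carry-switch A B y x 1≤t))

  -- For `A = B = 0` the waiting exponent `B + y ∸ A` is the original one.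
  runWeight-start : ∀ {k ℓ n} (w : Word k ℓ n) r s {t} → 1 ≤ k → 1 ≤ ℓ → Positive t →
                    runWeight (headIsˡ w) 0 0 w r s t ≡ weight w r s t
  runWeight-start w@(l∷ _) r (y ∷ s) _ _ p = runWeight-l 0 0 w r y s p
  runWeight-start w@(r∷ _) (x ∷ r) s _ _ p = runWeight-r 0 0 w x r s p

  -- The factor `coeff` relative to a suffix: the offsets `A` and `B` account for the letters
  -- removed in the induction of `product-localCoeff`.
  localCoeff : ∀ {k ℓ n} → Bool → ℕ → ℕ → Word k ℓ n →
               Vec ℕ k → Vec ℕ ℓ → Vec ℕ n → Fin n → ℕ
  localCoeff b A B w r s t i =
    if does (prevIsˡ b w i Bool.≟ isˡ w i)
    then binom (pred (lookup t i)) (lookup (merge w r s) i ⊖ 1)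
    else binom (pred (lookup t i))
           ((A ℕ.+ prefixSum t (suc (toℕ i)))
             ⊖ (B ℕ.+ (prefixSum r (countˡ w i) ℕ.+ prefixSum s (countʳ w i))))

  product-localCoeff : ∀ {k ℓ n} b A B (w : Word k ℓ n) r s t →
    ListAction.product (List.tabulate (localCoeff b A B w r s t)) ≡ runWeight b A B w r s t
  product-localCoeff b A B [] [] [] [] = refl
  product-localCoeff b A B (l∷ w) (x ∷ r) s (t ∷ ts) = cong₂ ℕ._*_
    (cong₂ (λ m n → if does (b Bool.≟ true) then binom (pred t) (x ⊖ 1)
                                            else binom (pred t) (m ⊖ n))
      (cong (A ℕ.+_) (ℕ.+-identityʳ t))
      (cong (B ℕ.+_) (trans (ℕ.+-identityʳ _) (ℕ.+-identityʳ x))))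
    (trans (cong ListAction.product (List.tabulate-cong λ i →
      cong₂ (λ m n → if does (prevIsˡ true w i Bool.≟ isˡ w i)
                     then binom (pred (lookup ts i)) (lookup (merge w r s) i ⊖ 1)
                     else binom (pred (lookup ts i)) (m ⊖ n))
        (sym (ℕ.+-assoc A t _))
        (trans (cong (B ℕ.+_) (ℕ.+-assoc x _ _)) (sym (ℕ.+-assoc B x _)))))
      (product-localCoeff true (A ℕ.+ t) (B ℕ.+ x) w r s ts))
  product-localCoeff b A B (r∷ w) r (y ∷ s) (t ∷ ts) = cong₂ ℕ._*_
    (cong₂ (λ m n → if does (b Bool.≟ false) then binom (pred t) (y ⊖ 1)
                                             else binom (pred t) (m ⊖ n))
      (cong (A ℕ.+_) (ℕ.+-identityʳ t))
      (cong (B ℕ.+_) (ℕ.+-identityʳ y)))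
    (trans (cong ListAction.product (List.tabulate-cong λ i →
      cong₂ (λ m n → if does (prevIsˡ false w i Bool.≟ isˡ w i)
                     then binom (pred (lookup ts i)) (lookup (merge w r s) i ⊖ 1)
                     else binom (pred (lookup ts i)) (m ⊖ n))
        (sym (ℕ.+-assoc A t _))
        (trans (cong (B ℕ.+_) (+ℕ.x∙yz≈y∙xz (prefixSum r (countˡ w i)) y _))
          (sym (ℕ.+-assoc B y _)))))
      (product-localCoeff false (A ℕ.+ t) (B ℕ.+ y) w r s ts))

  -- Comparison of a shuffle with a word

  lookup-merge-posˡ : ∀ {a} {A : Set a} {k ℓ n} (w : Word k ℓ n) (us : Vec A k) vs j →
                      lookup (merge w us vs) (posˡ w j) ≡ lookup us j
  lookup-merge-posˡ (l∷ w) (u ∷ us) vs zero = refl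
  lookup-merge-posˡ (l∷ w) (u ∷ us) vs (suc j) = lookup-merge-posˡ w us vs j
  lookup-merge-posˡ (r∷ w) us (v ∷ vs) j = lookup-merge-posˡ w us vs j

  lookup-merge-posʳ : ∀ {a} {A : Set a} {k ℓ n} (w : Word k ℓ n) (us : Vec A k) vs j →
                      lookup (merge w us vs) (posʳ w j) ≡ lookup vs j
  lookup-merge-posʳ (r∷ w) us (v ∷ vs) zero = refl
  lookup-merge-posʳ (r∷ w) us (v ∷ vs) (suc j) = lookup-merge-posʳ w us vs j
  lookup-merge-posʳ (l∷ w) (u ∷ us) vs j = lookup-merge-posʳ w us vs j

  isˡ-posˡ : ∀ {k ℓ n} (w : Word k ℓ n) j → isˡ w (posˡ w j) ≡ true
  isˡ-posˡ (l∷ w) zero = refl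
  isˡ-posˡ (l∷ w) (suc j) = isˡ-posˡ w j
  isˡ-posˡ (r∷ w) j = isˡ-posˡ w j

  isˡ-posʳ : ∀ {k ℓ n} (w : Word k ℓ n) j → isˡ w (posʳ w j) ≡ false
  isˡ-posʳ (r∷ w) zero = refl
  isˡ-posʳ (r∷ w) (suc j) = isˡ-posʳ w j
  isˡ-posʳ (l∷ w) j = isˡ-posʳ w j

  word-covering : ∀ {k ℓ n} (w : Word k ℓ n) i → (i ∈im posˡ w) ⊎ (i ∈im posʳ w)
  word-covering (l∷ w) zero = inj₁ (zero , refl)
  word-covering (r∷ w) zero = inj₂ (zero , refl)
  word-covering (l∷ w) (suc i) =
    Sum.map (λ (j , e) → suc j , cong suc e) (λ (j , e) → j , cong suc e) (word-covering w i)
  word-covering (r∷ w) (suc i) =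
    Sum.map (λ (j , e) → j , cong suc e) (λ (j , e) → suc j , cong suc e) (word-covering w i)

  prevIsˡ-pred : ∀ {k ℓ n} b (w : Word k ℓ n) i → toℕ i ≢ 0 →
                 prevIsˡ b w i ≡ isˡ w (Fin.pred i)
  prevIsˡ-pred b w zero i≢0 = contradiction refl i≢0
  prevIsˡ-pred b (l∷ (l∷ w)) (suc zero) _ = refl
  prevIsˡ-pred b (l∷ (r∷ w)) (suc zero) _ = refl
  prevIsˡ-pred b (r∷ (l∷ w)) (suc zero) _ = refl
  prevIsˡ-pred b (r∷ (r∷ w)) (suc zero) _ = refl
  prevIsˡ-pred b (l∷ w) (suc (suc i)) _ = prevIsˡ-pred true w (suc i) λ ()
  prevIsˡ-pred b (r∷ w) (suc (suc i)) _ = prevIsˡ-pred false w (suc i) λ ()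

  prevIsˡ-head : ∀ {k ℓ n} (w : Word k ℓ n) i → toℕ i ≡ 0 → prevIsˡ (headIsˡ w) w i ≡ isˡ w i
  prevIsˡ-head (l∷ w) zero _ = refl
  prevIsˡ-head (r∷ w) zero _ = refl

  -- The tail of `allFin (suc m)` is `tabulate suc`; reindexing it lets `preimageCount` be computed
  -- letter by letter.
  length-filter-tabulate : ∀ {a p} {A : Set a} {P : Pred A p} (P? : Decidable P) {m}
    (h : Fin m → A) → List.length (List.filter P? (List.tabulate h))
                      ≡ List.length (List.filter (P? ∘ h) (List.allFin m))
  length-filter-tabulate P? {zero} h = refl
  length-filter-tabulate P? {suc m} h
    with does (P? (h zero)) | trans (length-filter-tabulate P? (h ∘ suc))
                                (sym (length-filter-tabulate (P? ∘ h) suc))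
  ... | true | e = cong suc e
  ... | false | e = e

  preimageCount-cong : ∀ {m n} {φ ψ : Fin m → Fin n} → φ ≗ ψ →
                       preimageCount φ ≗ preimageCount ψ
  preimageCount-cong {φ = φ} {ψ} e i = cong List.length
    (List.filter-≐ (λ j → φ j Fin.≤? i) (λ j → ψ j Fin.≤? i)
      ((λ {j} → ≡.subst (Fin._≤ i) (e j)) , (λ {j} → ≡.subst (Fin._≤ i) (sym (e j))))
      (List.allFin _))

  preimageCount-suc∘-zero : ∀ {m n} (φ : Fin m → Fin n) → preimageCount (suc ∘ φ) zero ≡ 0
  preimageCount-suc∘-zero {n = n} φ = cong List.length
    (List.filter-none (λ j → suc (φ j) Fin.≤? zero {n})
      (ListAll.universal (λ _ ()) (List.allFin _)))

  preimageCount-suc∘-suc : ∀ {m n} (φ : Fin m → Fin n) i →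
                           preimageCount (suc ∘ φ) (suc i) ≡ preimageCount φ i
  preimageCount-suc∘-suc φ i = cong List.length
    (List.filter-≐ (λ j → suc (φ j) Fin.≤? suc i) (λ j → φ j Fin.≤? i)
      ((λ { (s≤s le) → le }) , s≤s) (List.allFin _))

  preimageCount-∷ : ∀ {m n} (φ : Fin (suc m) → Fin (suc n)) i → φ zero ≡ zero →
                    preimageCount φ i ≡ suc (preimageCount (φ ∘ suc) i)
  preimageCount-∷ φ i e rewrite e = cong suc (length-filter-tabulate (λ j → φ j Fin.≤? i) suc)

  preimageCount-posˡ : ∀ {k ℓ n} (w : Word k ℓ n) → preimageCount (posˡ w) ≗ countˡ w
  preimageCount-posˡ (l∷ w) zero =
    trans (preimageCount-∷ (posˡ (l∷ w)) zero refl)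
      (cong suc (preimageCount-suc∘-zero (posˡ w)))
  preimageCount-posˡ (l∷ w) (suc i) = trans (preimageCount-∷ (posˡ (l∷ w)) (suc i) refl)
    (cong suc (trans (preimageCount-suc∘-suc (posˡ w) i) (preimageCount-posˡ w i)))
  preimageCount-posˡ (r∷ w) zero = preimageCount-suc∘-zero (posˡ w)
  preimageCount-posˡ (r∷ w) (suc i) =
    trans (preimageCount-suc∘-suc (posˡ w) i) (preimageCount-posˡ w i)

  preimageCount-posʳ : ∀ {k ℓ n} (w : Word k ℓ n) → preimageCount (posʳ w) ≗ countʳ w
  preimageCount-posʳ (r∷ w) zero =
    trans (preimageCount-∷ (posʳ (r∷ w)) zero refl)
      (cong suc (preimageCount-suc∘-zero (posʳ w)))
  preimageCount-posʳ (r∷ w) (suc i) = trans (preimageCount-∷ (posʳ (r∷ w)) (suc i) refl)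
    (cong suc (trans (preimageCount-suc∘-suc (posʳ w) i) (preimageCount-posʳ w i)))
  preimageCount-posʳ (l∷ w) zero = preimageCount-suc∘-zero (posʳ w)
  preimageCount-posʳ (l∷ w) (suc i) =
    trans (preimageCount-suc∘-suc (posʳ w) i) (preimageCount-posʳ w i)

  module _ {k ℓ} (σ : Shuffle k ℓ) (w : Word k ℓ (k ℕ.+ ℓ))
    (φ≗ : Shuffle.φ σ ≗ posˡ w) (ψ≗ : Shuffle.ψ σ ≗ posʳ w) where
    open Shuffle σ

    -- Whichever alternative `covering` selects at a position, the entry found there is the one that
    -- `merge` has at that position.
    ш≡merge : ∀ {a} {A : Set a} (us : Vec A k) vs → us ш[ σ ] vs ≡ merge w us vs
    ш≡merge us vs = trans (Vec.tabulate-cong eq) (Vec.tabulate∘lookup (merge w us vs))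
      where
      eq : ∀ i → [ lookup us ∘ proj₁ , lookup vs ∘ proj₁ ]′ (covering i)
                   ≡ lookup (merge w us vs) i
      eq i with covering i
      ... | inj₁ (j , e) = sym (trans (cong (lookup (merge w us vs)) (trans e (φ≗ j)))
                                  (lookup-merge-posˡ w us vs j))
      ... | inj₂ (j , e) = sym (trans (cong (lookup (merge w us vs)) (trans e (ψ≗ j)))
                                  (lookup-merge-posʳ w us vs j))

    ∈imφ⇒isˡ : ∀ {i} → i ∈im φ → isˡ w i ≡ true
    ∈imφ⇒isˡ (j , e) = trans (cong (isˡ w) (trans e (φ≗ j))) (isˡ-posˡ w j)

    ∈imψ⇒¬isˡ : ∀ {i} → i ∈im ψ → isˡ w i ≡ false
    ∈imψ⇒¬isˡ (j , e) = trans (cong (isˡ w) (trans e (ψ≗ j))) (isˡ-posʳ w j)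

    sameSource⇔ : ∀ i → SameSource σ i ⇔ (prevIsˡ (headIsˡ w) w i ≡ isˡ w i)
    sameSource⇔ i = mk⇔ to from
      where
      to : SameSource σ i → _
      -- `Fin.pred` fixes zero, so the other alternatives can hold at the first position too; that
      -- position has to be settled before they are read.
      to s with toℕ i ℕ.≟ 0 | s
      ... | yes i≡0 | _ = prevIsˡ-head w i i≡0
      ... | no i≢0 | inj₁ i≡0 = contradiction i≡0 i≢0
      ... | no i≢0 | inj₂ (inj₁ (p , q)) =
        trans (prevIsˡ-pred (headIsˡ w) w i i≢0) (trans (∈imφ⇒isˡ p) (sym (∈imφ⇒isˡ q)))
      ... | no i≢0 | inj₂ (inj₂ (p , q)) =
        trans (prevIsˡ-pred (headIsˡ w) w i i≢0) (trans (∈imψ⇒¬isˡ p) (sym (∈imψ⇒¬isˡ q)))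
      from : prevIsˡ (headIsˡ w) w i ≡ isˡ w i → SameSource σ i
      from e with toℕ i ℕ.≟ 0
      ... | yes i≡0 = inj₁ i≡0
      ... | no i≢0 with covering (Fin.pred i) | covering i
      ...   | inj₁ p | inj₁ q = inj₂ (inj₁ (p , q))
      ...   | inj₂ p | inj₂ q = inj₂ (inj₂ (p , q))
      ...   | inj₁ p | inj₂ q with () ← trans (sym (∈imφ⇒isˡ p))
        (trans (sym (prevIsˡ-pred (headIsˡ w) w i i≢0)) (trans e (∈imψ⇒¬isˡ q)))
      ...   | inj₂ p | inj₁ q with () ← trans (sym (∈imψ⇒¬isˡ p))
        (trans (sym (prevIsˡ-pred (headIsˡ w) w i i≢0)) (trans e (∈imφ⇒isˡ q)))

    coeff≡localCoeff : ∀ r s t → coeff σ r s t ≗ localCoeff (headIsˡ w) 0 0 w r s t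
    coeff≡localCoeff r s t i
      rewrite does-⇔ (sameSource⇔ i) (sameSource? σ i)
                (prevIsˡ (headIsˡ w) w i Bool.≟ isˡ w i)
            | ш≡merge r s
            | trans (preimageCount-cong φ≗ i) (preimageCount-posˡ w i)
            | trans (preimageCount-cong ψ≗ i) (preimageCount-posʳ w i) = refl

    coeffProduct≡weight : ∀ r s {t} → 1 ≤ k → 1 ≤ ℓ → Positive t →
                          coeffProduct σ r s t ≡ weight w r s t
    coeffProduct≡weight r s {t} 1≤k 1≤ℓ p = begin
      coeffProduct σ r s t
        ≡⟨ cong ListAction.product (List.map-tabulate id (coeff σ r s t)) ⟩
      ListAction.product (List.tabulate (coeff σ r s t))
        ≡⟨ cong ListAction.product (List.tabulate-cong (coeff≡localCoeff r s t)) ⟩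
      ListAction.product (List.tabulate (localCoeff (headIsˡ w) 0 0 w r s t))
        ≡⟨ product-localCoeff (headIsˡ w) 0 0 w r s t ⟩
      runWeight (headIsˡ w) 0 0 w r s t
        ≡⟨ runWeight-start w r s 1≤k 1≤ℓ p ⟩
      weight w r s t ∎
      where open ≡.≡-Reasoning

  -- Enumeration of the shuffles

  ∈-mapMaybe⁺ : ∀ {a b} {A : Set a} {B : Set b} (g : A → Maybe B) {x y xs} →
                x ∈ xs → g x ≡ just y → y ∈ List.mapMaybe g xs
  ∈-mapMaybe⁺ g {xs = x ∷ xs} (here refl) e with just _ ← g x | refl ← e = here refl
  ∈-mapMaybe⁺ g {xs = x ∷ xs} (there x∈) e with g x
  ... | just _ = there (∈-mapMaybe⁺ g x∈ e)
  ... | nothing = ∈-mapMaybe⁺ g x∈ e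

  ∈-mapMaybe⁻ : ∀ {a b} {A : Set a} {B : Set b} (g : A → Maybe B) {y} xs →
                y ∈ List.mapMaybe g xs → ∃[ x ] x ∈ xs × g x ≡ just y
  ∈-mapMaybe⁻ g (x ∷ xs) y∈ with g x in eq | y∈
  ... | just _ | here refl = x , here refl , eq
  ... | just _ | there y∈′ = let z , z∈ , e = ∈-mapMaybe⁻ g xs y∈′ in z , there z∈ , e
  ... | nothing | y∈′ = let z , z∈ , e = ∈-mapMaybe⁻ g xs y∈′ in z , there z∈ , e

  unique-mapMaybe : ∀ {a b} {A : Set a} {B : Set b} (g : A → Maybe B) →
    (∀ {x x′ y} → g x ≡ just y → g x′ ≡ just y → x ≡ x′) →
    ∀ {xs} → Unique xs → Unique (List.mapMaybe g xs)
  unique-mapMaybe g inj {[]} [] = []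
  unique-mapMaybe g inj {x ∷ xs} (x∉ ∷ u) with g x in eq
  ... | nothing = unique-mapMaybe g inj u
  ... | just y = ListAll.tabulate (λ {y′} y′∈ y≡y′ →
      let z , z∈ , e = ∈-mapMaybe⁻ g xs y′∈
      in ListAll.lookup x∉ z∈ (inj eq (trans e (cong just (sym y≡y′)))))
    ∷ unique-mapMaybe g inj u

  unique-tuples : ∀ {a} {A : Set a} {xs : List A} → Unique xs → ∀ n → Unique (tuples xs n)
  unique-tuples u zero = [] ∷ []
  unique-tuples u (suc n) =
    Unique.cartesianProductWith⁺ _∷_ Vec.∷-injective u (unique-tuples u n)

  ∈-tuples : ∀ {a} {A : Set a} {xs : List A} → (∀ x → x ∈ xs) →
             ∀ {n} (t : Vec A n) → t ∈ tuples xs n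
  ∈-tuples all [] = here refl
  ∈-tuples all (x ∷ t) = ∈-cartesianProductWith⁺ _∷_ (all x) (∈-tuples all t)

  ∈-words : ∀ {k ℓ n} (w : Word k ℓ n) → w ∈ words k ℓ n
  ∈-words [] = here refl
  ∈-words {suc k} {zero} (l∷ w) = ∈-++⁺ˡ (∈-map⁺ l∷_ (∈-words w))
  ∈-words {suc k} {suc ℓ} (l∷ w) = ∈-++⁺ˡ (∈-map⁺ l∷_ (∈-words w))
  ∈-words {zero} {suc ℓ} (r∷ w) = ∈-map⁺ r∷_ (∈-words w)
  ∈-words {suc k} {suc ℓ} {suc n} (r∷ w) =
    ∈-++⁺ʳ (words-l (suc k) (suc ℓ) n) (∈-map⁺ r∷_ (∈-words w))

  unique-words : ∀ k ℓ n → Unique (words k ℓ n)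
  unique-words zero zero zero = [] ∷ []
  unique-words zero (suc ℓ) zero = []
  unique-words (suc k) ℓ zero = []
  unique-words zero zero (suc n) = []
  unique-words zero (suc ℓ) (suc n) = Unique.map⁺ (λ { refl → refl }) (unique-words zero ℓ n)
  unique-words (suc k) zero (suc n) =
    Unique.++⁺ (Unique.map⁺ (λ { refl → refl }) (unique-words k zero n)) [] λ ()
  unique-words (suc k) (suc ℓ) (suc n) = Unique.++⁺
    (Unique.map⁺ (λ { refl → refl }) (unique-words k (suc ℓ) n))
    (Unique.map⁺ (λ { refl → refl }) (unique-words (suc k) ℓ n))
    λ (p , q) → disjoint (∈-map⁻ l∷_ p) (∈-map⁻ r∷_ q)
    where
    disjoint : ∀ {w} → (∃[ v ] v ∈ words k (suc ℓ) n × w ≡ l∷ v) →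
               ¬ (∃[ v ] v ∈ words (suc k) ℓ n × w ≡ r∷ v)
    disjoint (_ , _ , refl) (_ , _ , ())

  pos-injective : ∀ {k ℓ n} (w w′ : Word k ℓ n) → posˡ w ≗ posˡ w′ → posʳ w ≗ posʳ w′ → w ≡ w′
  pos-injective [] [] _ _ = refl
  pos-injective (l∷ w) (l∷ w′) e e′ = cong l∷_
    (pos-injective w w′ (Fin.suc-injective ∘ e ∘ suc) (Fin.suc-injective ∘ e′))
  pos-injective (r∷ w) (r∷ w′) e e′ = cong r∷_
    (pos-injective w w′ (Fin.suc-injective ∘ e) (Fin.suc-injective ∘ e′ ∘ suc))
  pos-injective (l∷ w) (r∷ w′) e e′ with () ← e zero
  pos-injective (r∷ w) (l∷ w′) e e′ with () ← e zero

  posˡ-injective : ∀ {k ℓ n} (w : Word k ℓ n) → Injective (posˡ w)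
  posˡ-injective (l∷ w) zero zero _ = refl
  posˡ-injective (l∷ w) (suc i) (suc j) e =
    cong suc (posˡ-injective w i j (Fin.suc-injective e))
  posˡ-injective (r∷ w) i j e = posˡ-injective w i j (Fin.suc-injective e)

  posʳ-injective : ∀ {k ℓ n} (w : Word k ℓ n) → Injective (posʳ w)
  posʳ-injective (r∷ w) zero zero _ = refl
  posʳ-injective (r∷ w) (suc i) (suc j) e =
    cong suc (posʳ-injective w i j (Fin.suc-injective e))
  posʳ-injective (l∷ w) i j e = posʳ-injective w i j (Fin.suc-injective e)

  posˡ-mono : ∀ {k ℓ n} (w : Word k ℓ n) → OrderPreserving (posˡ w)
  posˡ-mono (l∷ w) zero j _ = z≤n
  posˡ-mono (l∷ w) (suc i) (suc j) (s≤s le) = s≤s (posˡ-mono w i j le)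
  posˡ-mono (r∷ w) i j le = s≤s (posˡ-mono w i j le)

  posʳ-mono : ∀ {k ℓ n} (w : Word k ℓ n) → OrderPreserving (posʳ w)
  posʳ-mono (r∷ w) zero j _ = z≤n
  posʳ-mono (r∷ w) (suc i) (suc j) (s≤s le) = s≤s (posʳ-mono w i j le)
  posʳ-mono (l∷ w) i j le = s≤s (posʳ-mono w i j le)

  -- If x were missed, punching it out would give an injection into a set with one element fewer.
  injective⇒surjective : ∀ {n} (g : Fin n → Fin n) → (∀ {i j} → g i ≡ g j → i ≡ j) →
                         ∀ x → ∃[ i ] g i ≡ x
  injective⇒surjective {suc n} g inj x with Fin.any? (λ i → g i Fin.≟ x)
  ... | yes hit = hit
  ... | no missed = contradiction
    (Fin.injective⇒≤ (inj ∘ Fin.punchOut-injective (x≢g _) (x≢g _))) ℕ.1+n≰n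
    where
    x≢g : ∀ i → x ≢ g i
    x≢g i x≡gi = missed (i , sym x≡gi)

  -- The codomain is freed from `k + ℓ`, so that a head can be removed and the two maps exchanged.
  -- Disjointness, which the count k + ℓ gave for shuffles, has to become a field.
  record Interleaving {k ℓ n} (φ : Fin k → Fin n) (ψ : Fin ℓ → Fin n) : Set where
    field
      φ-mono   : OrderPreserving φ
      φ-inj    : Injective φ
      ψ-mono   : OrderPreserving ψ
      ψ-inj    : Injective ψ
      disjoint : ∀ i j → φ i ≢ ψ j
      covering : ∀ i → i ∈im φ ⊎ i ∈im ψ

  -- The covering makes the k + ℓ positions an injective, hence surjective,
  -- image in the k + ℓ indices; two indices at one position could not both
  -- be hit.
  interleaving : ∀ {k ℓ} (σ : Shuffle k ℓ) → Interleaving (Shuffle.φ σ) (Shuffle.ψ σ)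
  interleaving {k} {ℓ} σ = record
    { φ-mono = φ-mono ; φ-inj = φ-inj ; ψ-mono = ψ-mono ; ψ-inj = ψ-inj
    ; covering = covering ; disjoint = disjoint }
    where
    open Shuffle σ
    source : Fin (k ℕ.+ ℓ) → Fin (k ℕ.+ ℓ)
    source i = Fin.join k ℓ (Sum.map proj₁ proj₁ (covering i))
    target : Fin (k ℕ.+ ℓ) → Fin (k ℕ.+ ℓ)
    target x = [ φ , ψ ]′ (Fin.splitAt k x)
    target-source : ∀ i → target (source i) ≡ i
    target-source i with covering i
    ... | inj₁ (j , e) = trans (cong [ φ , ψ ]′ (Fin.splitAt-↑ˡ k j ℓ)) (sym e)
    ... | inj₂ (j , e) = trans (cong [ φ , ψ ]′ (Fin.splitAt-↑ʳ k ℓ j)) (sym e)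
    source-injective : ∀ {i j} → source i ≡ source j → i ≡ j
    source-injective {i} {j} e =
      trans (sym (target-source i)) (trans (cong target e) (target-source j))
    source-target : ∀ x → source (target x) ≡ x
    source-target x with i , refl ← injective⇒surjective source source-injective x =
      cong source (target-source i)
    collide : ∀ i j → φ i ≡ ψ j → i Fin.↑ˡ ℓ ≡ k Fin.↑ʳ j
    collide i j e = trans (sym (source-target _)) (trans (cong source
      (trans (cong [ φ , ψ ]′ (Fin.splitAt-↑ˡ k i ℓ))
        (trans e (cong [ φ , ψ ]′ (sym (Fin.splitAt-↑ʳ k ℓ j)))))) (source-target _))
    disjoint : ∀ i j → φ i ≢ ψ j
    disjoint i j e with () ← trans (sym (Fin.splitAt-↑ˡ k i ℓ))
      (trans (cong (Fin.splitAt k) (collide i j e)) (Fin.splitAt-↑ʳ k ℓ j))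

  interleaving-swap : ∀ {k ℓ n} {φ : Fin k → Fin n} {ψ : Fin ℓ → Fin n} →
                      Interleaving φ ψ → Interleaving ψ φ
  interleaving-swap I = record
    { φ-mono = ψ-mono ; φ-inj = ψ-inj ; ψ-mono = φ-mono ; ψ-inj = φ-inj
    ; disjoint = λ i j → disjoint j i ∘ sym ; covering = Sum.swap ∘ covering }
    where open Interleaving I

  interleaving-head : ∀ {k ℓ n} {φ : Fin (suc k) → Fin (suc n)} {ψ : Fin ℓ → Fin (suc n)} →
                      Interleaving φ ψ → zero ∈im φ → φ zero ≡ zero
  interleaving-head I (j , e) = Fin.toℕ-injective
    (ℕ.n≤0⇒n≡0 (ℕ.≤-trans (φ-mono zero j z≤n) (ℕ.≤-reflexive (cong toℕ (sym e)))))
    where open Interleaving I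

  -- Injectivity keeps the rest of `φ` away from zero and disjointness keeps `ψ` away, so both can
  -- be lowered by one.
  interleaving-tail : ∀ {k ℓ n} {φ : Fin (suc k) → Fin (suc n)} {ψ : Fin ℓ → Fin (suc n)} →
    Interleaving φ ψ → φ zero ≡ zero →
    ∃[ φ′ ] ∃[ ψ′ ] Interleaving φ′ ψ′ × φ ∘ suc ≗ suc ∘ φ′ × ψ ≗ suc ∘ ψ′
  interleaving-tail {φ = φ} {ψ} I φ0≡0 = φ′ , ψ′ , record
    { φ-mono = λ i j le → ℕ.s≤s⁻¹ (≡.subst₂ Fin._≤_ (φ≗ i) (φ≗ j)
                 (φ-mono (suc i) (suc j) (s≤s le)))
    ; φ-inj = λ i j e → Fin.suc-injective
        (φ-inj (suc i) (suc j) (trans (φ≗ i) (trans (cong suc e) (sym (φ≗ j)))))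
    ; ψ-mono = λ i j le → ℕ.s≤s⁻¹ (≡.subst₂ Fin._≤_ (ψ≗ i) (ψ≗ j) (ψ-mono i j le))
    ; ψ-inj = λ i j e → ψ-inj i j (trans (ψ≗ i) (trans (cong suc e) (sym (ψ≗ j))))
    ; disjoint = λ i j e →
        disjoint (suc i) j (trans (φ≗ i) (trans (cong suc e) (sym (ψ≗ j))))
    ; covering = covering′ } , φ≗ , ψ≗
    where
    open Interleaving I
    0≢φ : ∀ i → zero ≢ φ (suc i)
    0≢φ i e with () ← φ-inj zero (suc i) (trans φ0≡0 e)
    0≢ψ : ∀ j → zero ≢ ψ j
    0≢ψ j e = disjoint zero j (trans φ0≡0 e)
    φ′ = λ i → Fin.punchOut (0≢φ i)
    ψ′ = λ j → Fin.punchOut (0≢ψ j)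
    φ≗ : φ ∘ suc ≗ suc ∘ φ′
    φ≗ i = sym (Fin.punchIn-punchOut (0≢φ i))
    ψ≗ : ψ ≗ suc ∘ ψ′
    ψ≗ j = sym (Fin.punchIn-punchOut (0≢ψ j))
    covering′ : ∀ i → i ∈im φ′ ⊎ i ∈im ψ′
    covering′ i with covering (suc i)
    ... | inj₁ (zero , e) with () ← trans e φ0≡0
    ... | inj₁ (suc j , e) = inj₁ (j , Fin.suc-injective (trans e (φ≗ j)))
    ... | inj₂ (j , e) = inj₂ (j , Fin.suc-injective (trans e (ψ≗ j)))

  -- The map that covers position zero supplies the first letter; by monotonicity it does so at its
  -- own index zero.
  toWord : ∀ n {k ℓ} {φ : Fin k → Fin n} {ψ : Fin ℓ → Fin n} → Interleaving φ ψ →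
           ∃[ w ] (φ ≗ posˡ w × ψ ≗ posʳ w)
  toWord zero {zero} {zero} I = [] , (λ ()) , λ ()
  toWord zero {suc k} {φ = φ} I with () ← φ zero
  toWord zero {zero} {suc ℓ} {ψ = ψ} I with () ← ψ zero
  toWord (suc n) {k} {ℓ} {φ} {ψ} I with Interleaving.covering I zero
  toWord (suc n) {suc k} {ℓ} {φ} {ψ} I | inj₁ 0∈
    with φ0≡0 ← interleaving-head I 0∈
    with φ′ , ψ′ , I′ , φ≗ , ψ≗ ← interleaving-tail I φ0≡0
    with w , e , e′ ← toWord n I′ =
    l∷ w , (λ { zero → φ0≡0 ; (suc j) → trans (φ≗ j) (cong suc (e j)) })
         , λ j → trans (ψ≗ j) (cong suc (e′ j))
  toWord (suc n) {k} {suc ℓ} {φ} {ψ} I | inj₂ 0∈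
    with ψ0≡0 ← interleaving-head (interleaving-swap I) 0∈
    with ψ′ , φ′ , I′ , ψ≗ , φ≗ ← interleaving-tail (interleaving-swap I) ψ0≡0
    with w , e , e′ ← toWord n (interleaving-swap I′) =
    r∷ w , (λ j → trans (φ≗ j) (cong suc (e j)))
         , λ { zero → ψ0≡0 ; (suc j) → trans (ψ≗ j) (cong suc (e′ j)) }

  module _ {k ℓ : ℕ} where

    wordOf : Shuffle k ℓ → Word k ℓ (k ℕ.+ ℓ)
    wordOf σ = proj₁ (toWord (k ℕ.+ ℓ) (interleaving σ))

    φ≗posˡ : ∀ σ → Shuffle.φ σ ≗ posˡ (wordOf σ)
    φ≗posˡ σ = proj₁ (proj₂ (toWord (k ℕ.+ ℓ) (interleaving σ)))

    ψ≗posʳ : ∀ σ → Shuffle.ψ σ ≗ posʳ (wordOf σ)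
    ψ≗posʳ σ = proj₂ (proj₂ (toWord (k ℕ.+ ℓ) (interleaving σ)))

    Table : Set
    Table = Vec (Fin (k ℕ.+ ℓ)) k × Vec (Fin (k ℕ.+ ℓ)) ℓ

    tables : List Table
    tables = List.cartesianProduct (tuples (List.allFin (k ℕ.+ ℓ)) k)
                                   (tuples (List.allFin (k ℕ.+ ℓ)) ℓ)

    table : Word k ℓ (k ℕ.+ ℓ) → Table
    table w = Vec.tabulate (posˡ w) , Vec.tabulate (posʳ w)

    tableShuffle : Table → Maybe (Shuffle k ℓ)
    tableShuffle (φ , ψ) = shuffle? (lookup φ) (lookup ψ)

    tableWord : Table → Maybe (Word k ℓ (k ℕ.+ ℓ))
    tableWord = Maybe.map wordOf ∘ tableShuffle

    map-just⁻ : ∀ {a b} {A : Set a} {B : Set b} {g : A → B} m {y} →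
                Maybe.map g m ≡ just y → ∃[ x ] m ≡ just x × g x ≡ y
    map-just⁻ (just x) refl = x , refl , refl

    map-just-resp : ∀ {a b p} {A : Set a} {B : Set b} {g : A → B} (P : B → Set p) →
                    (∀ x → P (g x)) → ∀ m {y} → Maybe.map g m ≡ just y → P y
    map-just-resp P Pg (just x) refl = Pg x

    dec⇒maybe-just : ∀ {a} {A : Set a} (a? : Dec A) → A → ∃[ x ] dec⇒maybe a? ≡ just x
    dec⇒maybe-just (yes x) _ = x , refl
    dec⇒maybe-just (no ¬x) x = contradiction x ¬x

    isShuffle? : (φ : Fin k → Fin (k ℕ.+ ℓ)) (ψ : Fin ℓ → Fin (k ℕ.+ ℓ)) →
      Dec (OrderPreserving φ × Injective φ × OrderPreserving ψ × Injective ψ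
           × (∀ i → i ∈im φ ⊎ i ∈im ψ))
    isShuffle? φ ψ = orderPreserving? φ ×-dec injective? φ ×-dec
                     orderPreserving? ψ ×-dec injective? ψ ×-dec
                     Fin.all? λ i → (i ∈im? φ) ⊎-dec (i ∈im? ψ)

    shuffle?-just : ∀ φ ψ {σ : Shuffle k ℓ} → shuffle? φ ψ ≡ just σ →
                    Shuffle.φ σ ≡ φ × Shuffle.ψ σ ≡ ψ
    shuffle?-just φ ψ = map-just-resp
      (λ σ → Shuffle.φ σ ≡ φ × Shuffle.ψ σ ≡ ψ) (λ _ → refl , refl)
      (dec⇒maybe (isShuffle? φ ψ))

    -- A word determines its table, so distinct tables cannot yield the same word. This makes the
    -- list of words obtained from `shuffles` free of repetitions.
    tableWord-just : ∀ x {w} → tableWord x ≡ just w → x ≡ table w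
    tableWord-just (φ , ψ) e
      with σ , e′ , refl ← map-just⁻ (shuffle? (lookup φ) (lookup ψ)) e
      with eφ , eψ ← shuffle?-just (lookup φ) (lookup ψ) e′ = cong₂ _,_
      (trans (sym (Vec.tabulate∘lookup φ))
        (Vec.tabulate-cong (λ j → trans (sym (≡.cong-app eφ j)) (φ≗posˡ σ j))))
      (trans (sym (Vec.tabulate∘lookup ψ))
        (Vec.tabulate-cong (λ j → trans (sym (≡.cong-app eψ j)) (ψ≗posʳ σ j))))

    shuffle?-word : ∀ φ ψ (w : Word k ℓ (k ℕ.+ ℓ)) → φ ≗ posˡ w → ψ ≗ posʳ w →
                    ∃[ σ ] shuffle? φ ψ ≡ just σ
    shuffle?-word φ ψ w e e′ = _ , cong (Maybe.map _) (proj₂ (dec⇒maybe-just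
      (isShuffle? φ ψ)
      ( (λ i j le → ≡.subst₂ Fin._≤_ (sym (e i)) (sym (e j)) (posˡ-mono w i j le))
      , (λ i j eq → posˡ-injective w i j (trans (sym (e i)) (trans eq (e j))))
      , (λ i j le → ≡.subst₂ Fin._≤_ (sym (e′ i)) (sym (e′ j)) (posʳ-mono w i j le))
      , (λ i j eq → posʳ-injective w i j (trans (sym (e′ i)) (trans eq (e′ j))))
      , λ i → Sum.map (λ (j , p) → j , trans p (sym (e j)))
                      (λ (j , p) → j , trans p (sym (e′ j))) (word-covering w i))))

    tableWord-table : ∀ w → tableWord (table w) ≡ just w
    -- `lookup` of a tabulation agrees with the position map only pointwise, so the claim is
    -- generalised to arbitrary maps with that property.
    tableWord-table w = lemma _ _ (Vec.lookup∘tabulate (posˡ w)) (Vec.lookup∘tabulate (posʳ w))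
      where
      lemma : ∀ φ ψ → φ ≗ posˡ w → ψ ≗ posʳ w → Maybe.map wordOf (shuffle? φ ψ) ≡ just w
      lemma φ ψ e e′
        with σ , eq ← shuffle?-word φ ψ w e e′
        with eφ , eψ ← shuffle?-just φ ψ eq =
        trans (cong (Maybe.map wordOf) eq) (cong just (pos-injective (wordOf σ) w
          (λ j → trans (sym (φ≗posˡ σ j)) (trans (≡.cong-app eφ j) (e j)))
          (λ j → trans (sym (ψ≗posʳ σ j)) (trans (≡.cong-app eψ j) (e′ j)))))

    -- Both lists are free of repetitions and contain every word. Comparing words instead of
    -- shuffles avoids equality of the proofs stored in a shuffle.
    wordOf-shuffles : List.map wordOf (shuffles k ℓ) ↭ words k ℓ (k ℕ.+ ℓ)
    wordOf-shuffles = ↭.↭-trans (↭.↭-reflexive (List.map-mapMaybe wordOf tableShuffle tables))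
      (∼bag⇒↭ (unique∧set⇒bag
        (unique-mapMaybe tableWord
          (λ e e′ → trans (tableWord-just _ e) (sym (tableWord-just _ e′)))
          (Unique.cartesianProduct⁺ (unique-tuples (Unique.allFin⁺ _) k)
                                    (unique-tuples (Unique.allFin⁺ _) ℓ)))
        (unique-words k ℓ (k ℕ.+ ℓ))
        (λ {w} → mk⇔ (λ _ → ∈-words w)
          (λ _ → ∈-mapMaybe⁺ tableWord
            (∈-cartesianProduct⁺ (∈-tuples ∈-allFin (proj₁ (table w)))
                                (∈-tuples ∈-allFin (proj₂ (table w))))
            (tableWord-table w)))))

-- Expansion of the product

∈range⇒≥1 : ∀ {M t} → t ∈ range M → 1 ≤ t
∈range⇒≥1 t∈ with _ , _ , ≡.refl ← ∈-map⁻ suc t∈ = s≤s z≤n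

positive-tuples : ∀ {M} n {t} → t ∈ tuples (range M) n → Positive t
positive-tuples zero (here ≡.refl) = []
positive-tuples {M} (suc n) t∈
  with _ , _ , x∈ , ts∈ , ≡.refl
    ← ∈-cartesianProductWith⁻ _∷_ (range M) (tuples (range M) n) t∈
  = ∈range⇒≥1 x∈ ∷ positive-tuples n ts∈

-- The bound M stays fixed in the induction, while N decreases.
boundedCompositions : ℕ → (n N : ℕ) → List (Vec ℕ n)
boundedCompositions M n N = List.filter (λ t → sum t ℕ.≟ N) (tuples (range M) n)

module ShuffleExpansion
  {c ℓ′} (R : CommutativeSemiring c ℓ′) (E : ℕEmbedding R) {a} {U : Set a}
  (inv : ∀ {n} → Vec U n → CommutativeSemiring.Carrier R)
  (F : ∀ {n} → Vec ℕ n → Vec U n → CommutativeSemiring.Carrier R)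
  where

  open CommutativeSemiring R hiding (zero)
  open ℕEmbedding E
  open FiniteSum R
  open PartialFractions R E
  open Exp semiring using (_^_; ^-congˡ)
  open CommutativeSemigroupProperties *-commutativeSemigroup
    using (interchange; x∙yz≈y∙xz)
  open SetoidReasoning setoid

  Sum : ∀ {k ℓ n} → List (Word k ℓ n) → ℕ → ℕ →
        (Word k ℓ n → Vec ℕ n → ℕ) → (Word k ℓ n → Vec U n) → Carrier
  Sum {n = n} ws M N κ m =
    ∑ ws (λ w → ∑ (boundedCompositions M n N) (λ t → ι (κ w t) * F t (m w)))

  module Expand
    (F-[] : F [] [] ≈ 1#)
    (F-∷ : ∀ {n} s (ss : Vec ℕ n) u us →
           F (s ∷ ss) (u ∷ us) ≈ inv (u ∷ us) ^ s * F ss us)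
    (inv-* : ∀ {m n} u (us : Vec U m) v (vs : Vec U n) →
             inv (u ∷ us) * inv (v ∷ vs)
               ≈ inv ((u ∷ us) Vec.++ (v ∷ vs)) * (inv (u ∷ us) + inv (v ∷ vs)))
    (inv-merge : ∀ {k ℓ n} (w : Word k ℓ n) us vs →
                 inv (merge w us vs) ≈ inv (us Vec.++ vs))
    (inv-++[] : ∀ {n} (us : Vec U n) → inv (us Vec.++ []) ≈ inv us)
    where

    -- The letter `y` is put before all words of `ws`, with `g` being `l∷_` or `r∷_`. The inverse of
    -- the sum of all variables does not depend on the word, hence the common value `C`.
    module _ {k ℓ n k′ ℓ′} (ws : List (Word k ℓ n))
      (m : Word k ℓ n → Vec U n) (y : U)
      (g : Word k ℓ n → Word k′ ℓ′ (suc n)) (m′ : Word k′ ℓ′ (suc n) → Vec U (suc n))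
      (m′≡ : ∀ w → m′ (g w) ≡ y ∷ m w)
      {C} (inv≈ : ∀ w → inv (y ∷ m w) ≈ C)
      (κ′ : Word k′ ℓ′ (suc n) → Vec ℕ (suc n) → ℕ)
      (M N : ℕ)
      where

      private
        tails : ℕ → List (Vec ℕ n)
        tails t = List.filter (λ ts → t ℕ.+ sum ts ℕ.≟ N) (tuples (range M) n)

      -- Neither `b t` nor `C ^ t` depends on the word, so the sum over the first exponent can be
      -- drawn outside the sum over words.
      peel : (b : ℕ → ℕ) (κ : Word k ℓ n → ℕ → Vec ℕ n → ℕ) →
        (∀ w t ts → κ′ (g w) (t ∷ ts) ≡ b t ℕ.* κ w t ts) →
        Sum (List.map g ws) M N κ′ m′
          ≈ ∑ (range M) (λ t → ι (b t) * (C ^ t *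
              ∑ ws (λ w → ∑ (tails t)
                (λ ts → ι (κ w t ts) * F ts (m w)))))
      peel b κ e = begin
        Sum (List.map g ws) M N κ′ m′
          ≈⟨ ∑-map g ws _ ⟩
        ∑ ws (λ w → ∑ (boundedCompositions M (suc n) N)
          (λ t → ι (κ′ (g w) t) * F t (m′ (g w))))
          ≈⟨ ∑-cong ws (λ w → ∑-filter-cartesianProductWith (λ t → sum t ℕ.≟ N) _∷_
               (range M) (tuples (range M) n) _) ⟩
        ∑ ws (λ w → ∑ (range M) (λ t → ∑ (tails t)
          (λ ts → ι (κ′ (g w) (t ∷ ts)) * F (t ∷ ts) (m′ (g w)))))
          ≈⟨ ∑-swap ws (range M) _ ⟩
        ∑ (range M) (λ t → ∑ ws (λ w → ∑ (tails t)
          (λ ts → ι (κ′ (g w) (t ∷ ts)) * F (t ∷ ts) (m′ (g w)))))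
          ≈⟨ ∑-cong (range M) (λ t → begin
             ∑ ws (λ w → ∑ (tails t) (λ ts → ι (κ′ (g w) (t ∷ ts)) * F (t ∷ ts) (m′ (g w))))
               ≈⟨ ∑-cong ws (λ w → trans (∑-cong (tails t) (term w t))
                    (sym (trans (*-congˡ (*-∑ (tails t) (C ^ t) _)) (*-∑ (tails t) (ι (b t)) _)))) ⟩
             ∑ ws (λ w → ι (b t) * (C ^ t * ∑ (tails t) (λ ts → ι (κ w t ts) * F ts (m w))))
               ≈⟨ trans (*-congˡ (*-∑ ws (C ^ t) _)) (*-∑ ws (ι (b t)) _) ⟨
             ι (b t) * (C ^ t * ∑ ws (λ w → ∑ (tails t) (λ ts → ι (κ w t ts) * F ts (m w)))) ∎) ⟩
        ∑ (range M) (λ t → ι (b t) * (C ^ t *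
              ∑ ws (λ w → ∑ (tails t) (λ ts → ι (κ w t ts) * F ts (m w))))) ∎
        where
        term : ∀ w t ts → ι (κ′ (g w) (t ∷ ts)) * F (t ∷ ts) (m′ (g w))
                          ≈ ι (b t) * (C ^ t * (ι (κ w t ts) * F ts (m w)))
        term w t ts rewrite m′≡ w | e w t ts = begin
          ι (b t ℕ.* κ w t ts) * F (t ∷ ts) (y ∷ m w)
            ≈⟨ *-cong (ι-* (b t) (κ w t ts))
                 (trans (F-∷ t ts y (m w)) (*-congʳ (^-congˡ t (inv≈ w)))) ⟩
          (ι (b t) * ι (κ w t ts)) * (C ^ t * F ts (m w))
            ≈⟨ trans (*-assoc _ _ _) (*-congˡ (x∙yz≈y∙xz _ _ _)) ⟩
          ι (b t) * (C ^ t * (ι (κ w t ts) * F ts (m w))) ∎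

      private
        sameFilter : ∀ {t N₀} → t ℕ.+ N₀ ≡ N →
          tails t ≡ boundedCompositions M n N₀
        sameFilter {t} ≡.refl = List.filter-≐ _ _
          (ℕ.+-cancelˡ-≡ t _ _ , ≡.cong (t ℕ.+_)) (tuples (range M) n)

      -- The case of an exhausted word. The binomial rules out t < suc x; for t > suc x the support
      -- condition `supp` would push the total above `N`. The surviving binomial is 1.
      peel-single : ∀ x {N₀ Q} (κ : Word k ℓ n → Vec ℕ n → ℕ) →
        (∀ w t ts → κ′ (g w) (t ∷ ts) ≡ binom (pred t) (suc x ⊖ 1) ℕ.* κ w ts) →
        (∀ w {ts} → Positive ts → κ w ts ≡ 0 ⊎ N₀ ≤ sum ts) →
        suc x ℕ.+ N₀ ≡ N → N ≤ M →
        Q ≈ Sum ws M N₀ κ m →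
        C ^ suc x * Q ≈ Sum (List.map g ws) M N κ′ m′
      peel-single x {N₀} {Q} κ e supp N≡ N≤M ih = sym (begin
        Sum (List.map g ws) M N κ′ m′
          ≈⟨ peel (λ t → binom (pred t) (suc x ⊖ 1)) (λ w _ → κ w) e ⟩
        ∑ (range M) h
          ≈⟨ ∑-single h (Unique.map⁺ ℕ.suc-injective (Unique.upTo⁺ M))
               (∈-map⁺ suc (∈-upTo⁺ (ℕ.≤-trans (ℕ.m≤m+n (suc x) N₀)
                 (ℕ.≤-trans (ℕ.≤-reflexive N≡) N≤M))))
               others ⟩
        h (suc x)
          ≈⟨ trans (*-congʳ (trans (reflexive (≡.cong ι (nCn≡1 x))) ι-1)) (*-identityˡ _) ⟩
        C ^ suc x * ∑ ws (λ w → ∑ (tails (suc x)) (λ ts → ι (κ w ts) * F ts (m w)))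
          ≡⟨ ≡.cong (λ L → C ^ suc x * ∑ ws (λ w → ∑ L (λ ts → ι (κ w ts) * F ts (m w))))
               (sameFilter N≡) ⟩
        C ^ suc x * Sum ws M N₀ κ m
          ≈⟨ *-congˡ ih ⟨
        C ^ suc x * Q ∎)
        where
        h : ℕ → Carrier
        h t = ι (binom (pred t) (suc x ⊖ 1)) * (C ^ t *
                ∑ ws (λ w → ∑ (tails t) (λ ts → ι (κ w ts) * F ts (m w))))
        others : ∀ {t} → t ∈ range M → t ≢ suc x → h t ≈ 0#
        others {t} t∈ t≢ with binom≢0⊎≤ (suc x) (∈range⇒≥1 t∈)
        ... | inj₁ b≡0 = ι0* _ b≡0
        ... | inj₂ x<t = trans (*-congˡ (trans (*-congˡ (∑-zero ws λ w →
          ∑-zero-∈ (tails t) (zero-term w))) (zeroʳ _))) (zeroʳ _)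
          where
          zero-term : ∀ w {ts} → ts ∈ tails t → ι (κ w ts) * F ts (m w) ≈ 0#
          zero-term w {ts} ts∈
            with ts∈′ , t+ts≡N
              ← ∈-filter⁻ (λ ts → t ℕ.+ sum ts ℕ.≟ N) {xs = tuples (range M) n} ts∈
            with supp w (positive-tuples n ts∈′)
          ... | inj₁ κ≡0 = ι0* _ κ≡0
          ... | inj₂ N₀≤ = contradiction (≡.trans N≡ (≡.sym t+ts≡N))
            (ℕ.<⇒≢ (ℕ.+-mono-<-≤ (ℕ.≤∧≢⇒< x<t (t≢ ∘ ≡.sym)) N₀≤))

      -- Each t leaves the other word a leading exponent `suc x + suc z ∸ t`. If it is positive,
      -- `ih` applies; if it is 0, the weights vanish by `κ0`, in step with `B ^⁺ 0 = 0#`.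
      peel-carry : ∀ x z {B N₀ Q} (κ : Word k ℓ n → ℕ → Vec ℕ n → ℕ) →
        (∀ w t ts → κ′ (g w) (t ∷ ts)
                      ≡ binom (pred t) (suc x ⊖ 1) ℕ.* κ w (suc x ℕ.+ suc z ∸ t) ts) →
        (∀ w {ts} → Positive ts → κ w 0 ts ≡ 0) →
        suc x ℕ.+ suc z ℕ.+ N₀ ≡ N → N ≤ M →
        (∀ d → suc d ℕ.+ N₀ ≤ M →
          B ^ suc d * Q ≈ Sum ws M (suc d ℕ.+ N₀) (λ w → κ w (suc d)) m) →
        Sum (List.map g ws) M N κ′ m′ ≈ expansion M C B (suc x) (suc z) * Q
      peel-carry x z {B} {N₀} {Q} κ e κ0 N≡ N≤M ih = begin
        Sum (List.map g ws) M N κ′ m′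
          ≈⟨ peel (λ t → binom (pred t) (suc x ⊖ 1)) (λ w t → κ w (suc x ℕ.+ suc z ∸ t)) e ⟩
        ∑ (range M) (λ t → ι (binom (pred t) (suc x ⊖ 1)) * (C ^ t * S t))
          ≈⟨ ∑-map suc (List.upTo M) _ ⟩
        ∑ (List.upTo M) (λ t → ι (t choose x) * (C ^ suc t * S (suc t)))
          ≈⟨ ∑-cong (List.upTo M) (λ t → trans (*-congˡ (trans (*-congˡ (S≈ t _ ≡.refl))
               (sym (*-assoc _ _ Q)))) (sym (*-assoc _ _ Q))) ⟩
        ∑ (List.upTo M) (λ t → (ι (t choose x) * (C ^ suc t * B ^⁺ (x ℕ.+ suc z ∸ t))) * Q)
          ≈⟨ ∑-* (List.upTo M) Q _ ⟨
        expansion M C B (suc x) (suc z) * Q ∎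
        where
        S : ℕ → Carrier
        S t = ∑ ws (λ w → ∑ (tails t) (λ ts → ι (κ w (suc x ℕ.+ suc z ∸ t) ts) * F ts (m w)))
        S≈ : ∀ t d → x ℕ.+ suc z ∸ t ≡ d → S (suc t) ≈ B ^⁺ (x ℕ.+ suc z ∸ t) * Q
        S≈ t d d≡ rewrite d≡ with d
        ... | zero = trans (∑-zero ws λ w → ∑-zero-∈ (tails (suc t)) λ ts∈ →
            ι0* _ (κ0 w (positive-tuples n (proj₁
              (∈-filter⁻ (λ ts → suc t ℕ.+ sum ts ℕ.≟ N) {xs = tuples (range M) n} ts∈)))))
          (sym (zeroˡ Q))
        ... | suc d = trans
          (reflexive (≡.cong (λ L → ∑ ws (λ w → ∑ L (λ ts → ι (κ w (suc d) ts) * F ts (m w))))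
            (sameFilter N≡′)))
          (sym (ih d (ℕ.≤-trans (ℕ.m≤n+m _ (suc t)) (ℕ.≤-trans (ℕ.≤-reflexive N≡′) N≤M))))
          where
          -- A positive difference has not been truncated, so t can be added back.
          t+d≡ : suc t ℕ.+ suc d ≡ suc x ℕ.+ suc z
          t+d≡ = ≡.trans (≡.cong (suc t ℕ.+_) (≡.sym d≡)) (≡.cong suc (ℕ.m+[n∸m]≡n
            (ℕ.<⇒≤ (ℕ.m∸n≢0⇒n<m {x ℕ.+ suc z} {t} λ eq → ℕ.1+n≢0 (≡.trans (≡.sym d≡) eq)))))
          N≡′ : suc t ℕ.+ (suc d ℕ.+ N₀) ≡ N
          N≡′ = ≡.trans (≡.sym (ℕ.+-assoc (suc t) (suc d) N₀))
            (≡.trans (≡.cong (ℕ._+ N₀) t+d≡) N≡)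

    -- Induction on the number of letters, because a modified exponent may exceed the original one.
    -- The equation for `n` excludes the indices without words.
    expand : ∀ k ℓ n → n ≡ k ℕ.+ ℓ → ∀ M {N}
      (r : Vec ℕ k) (s : Vec ℕ ℓ) → Positive r → Positive s →
      (u : Vec U k) (v : Vec U ℓ) → sum r ℕ.+ sum s ≡ N → N ≤ M →
      F r u * F s v
        ≈ Sum (words k ℓ n) M N (λ w t → weight w r s t) (λ w → merge w u v)
    expand zero zero zero _ M [] [] [] [] [] [] ≡.refl _ = begin
      F [] [] * F [] []         ≈⟨ *-congʳ F-[] ⟩
      1# * F [] []              ≈⟨ *-congʳ ι-1 ⟨
      ι 1 * F [] []             ≈⟨ trans (+-identityʳ _) (+-identityʳ _) ⟨
      ι 1 * F [] [] + 0# + 0#   ∎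
    expand (suc k) zero (suc n) n≡ M {N} (suc x ∷ r) [] (_ ∷ r⁺) [] (y ∷ u) [] N≡ N≤M = begin
      F (suc x ∷ r) (y ∷ u) * F [] []
        ≈⟨ trans (*-congʳ (F-∷ (suc x) r y u)) (*-assoc _ _ _) ⟩
      inv (y ∷ u) ^ suc x * (F r u * F [] [])
        ≈⟨ peel-single (words k 0 n) (λ w → merge w u []) y l∷_ (λ w → merge w (y ∷ u) [])
             (λ _ → ≡.refl)
             (λ w → trans (inv-merge (l∷ w) (y ∷ u) []) (inv-++[] (y ∷ u)))
             (λ w t → weight w (suc x ∷ r) [] t) M N x
             (λ w ts → weight w r [] ts) (λ _ _ _ → ≡.refl)
             (λ w → weight-support w r [])
             (≡.trans (≡.sym (ℕ.+-assoc (suc x) (sum r) 0)) N≡) N≤M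
             (expand k zero n (ℕ.suc-injective n≡) M r [] r⁺ [] u [] ≡.refl
               (ℕ.≤-trans (ℕ.m≤n+m _ (suc x)) (ℕ.≤-trans
                 (ℕ.≤-reflexive (≡.trans (≡.sym (ℕ.+-assoc (suc x) (sum r) 0)) N≡)) N≤M))) ⟩
      Sum (List.map l∷_ (words k 0 n)) M N _ _
        ≡⟨ ≡.cong (λ ws → Sum ws M N (λ w t → weight w (suc x ∷ r) [] t)
                            (λ w → merge w (y ∷ u) []))
             (List.++-identityʳ (List.map l∷_ (words k 0 n))) ⟨
      Sum (words (suc k) 0 (suc n)) M N _ _ ∎
    expand zero (suc ℓ) (suc n) n≡ M {N} [] (suc x ∷ s) [] (_ ∷ s⁺) [] (y ∷ v) N≡ N≤M = begin
      F [] [] * F (suc x ∷ s) (y ∷ v)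
        ≈⟨ trans (*-congˡ (F-∷ (suc x) s y v)) (x∙yz≈y∙xz _ _ _) ⟩
      inv (y ∷ v) ^ suc x * (F [] [] * F s v)
        ≈⟨ peel-single (words 0 ℓ n) (λ w → merge w [] v) y r∷_ (λ w → merge w [] (y ∷ v))
             (λ _ → ≡.refl)
             (λ w → inv-merge (r∷ w) [] (y ∷ v))
             (λ w t → weight w [] (suc x ∷ s) t) M N x
             (λ w ts → weight w [] s ts) (λ _ _ _ → ≡.refl)
             (λ w → weight-support w [] s)
             N≡ N≤M
             (expand zero ℓ n (ℕ.suc-injective n≡) M [] s [] s⁺ [] v ≡.refl
               (ℕ.≤-trans (ℕ.m≤n+m _ (suc x)) (ℕ.≤-trans (ℕ.≤-reflexive N≡) N≤M))) ⟩
      Sum (words 0 (suc ℓ) (suc n)) M N _ _ ∎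
    expand (suc k) (suc ℓ) (suc n) n≡ M {N} (suc x ∷ r) (suc z ∷ s) (_ ∷ r⁺) (_ ∷ s⁺)
           (y ∷ u) (y′ ∷ v) N≡ N≤M = begin
      F (suc x ∷ r) (y ∷ u) * F (suc z ∷ s) (y′ ∷ v)
        ≈⟨ *-cong (F-∷ (suc x) r y u) (F-∷ (suc z) s y′ v) ⟩
      (A ^ suc x * F r u) * (B ^ suc z * F s v)
        ≈⟨ interchange _ _ _ _ ⟩
      (A ^ suc x * B ^ suc z) * Q
        ≈⟨ *-congʳ (partialFractions (inv-* y u y′ v) M (suc x) (suc z) (s≤s z≤n)
             (ℕ.≤-trans (ℕ.m≤m+n _ N₀) (ℕ.≤-trans (ℕ.≤-reflexive Nˡ) (ℕ.m≤n⇒m≤1+n N≤M)))) ⟩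
      (expansion M C B (suc x) (suc z) + expansion M C A (suc z) (suc x)) * Q
        ≈⟨ distribʳ Q _ _ ⟩
      expansion M C B (suc x) (suc z) * Q + expansion M C A (suc z) (suc x) * Q
        ≈⟨ +-cong
             (peel-carry (words k (suc ℓ) n) (λ w → merge w u (y′ ∷ v)) y l∷_ m′
               (λ _ → ≡.refl)
               (λ w → inv-merge (l∷ w) (y ∷ u) (y′ ∷ v)) κ′ M N x z
               (λ w d → weight w r (d ∷ s)) (λ _ _ _ → ≡.refl) (λ w → weight-zero-r w r s)
               Nˡ N≤M
               -- The power of `B` rejoins `F s v` as its leading factor, so that the induction
               -- hypothesis meets a product of two fractions again.
               (λ d le → trans
                 (trans (x∙yz≈y∙xz _ _ _) (*-congˡ (sym (F-∷ (suc d) s y′ v))))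
                 (expand k (suc ℓ) n (ℕ.suc-injective n≡) M r (suc d ∷ s) r⁺ (s≤s z≤n ∷ s⁺)
                   u (y′ ∷ v) (+ℕ.x∙yz≈y∙xz (sum r) (suc d) (sum s)) le)))
             (peel-carry (words (suc k) ℓ n) (λ w → merge w (y ∷ u) v) y′ r∷_ m′
               (λ _ → ≡.refl)
               (λ w → inv-merge (r∷ w) (y ∷ u) (y′ ∷ v)) κ′ M N z x
               (λ w d → weight w (d ∷ r) s) (λ _ _ _ → ≡.refl) (λ w → weight-zero-l w r s)
               (≡.trans (≡.cong (ℕ._+ N₀) (ℕ.+-comm (suc z) (suc x))) Nˡ) N≤M
               (λ d le → trans
                 (trans (sym (*-assoc _ _ _)) (*-congʳ (sym (F-∷ (suc d) r y u))))
                 (expand (suc k) ℓ n (≡.trans (ℕ.suc-injective n≡) (ℕ.+-suc k ℓ)) M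
                   (suc d ∷ r) s (s≤s z≤n ∷ r⁺) s⁺
                   (y ∷ u) v (ℕ.+-assoc (suc d) (sum r) (sum s)) le))) ⟨
      Sum (List.map l∷_ (words k (suc ℓ) n)) M N κ′ m′
        + Sum (List.map r∷_ (words (suc k) ℓ n)) M N κ′ m′
        ≈⟨ ∑-++ (List.map l∷_ (words k (suc ℓ) n)) (List.map r∷_ (words (suc k) ℓ n)) _ ⟨
      Sum (words (suc k) (suc ℓ) (suc n)) M N κ′ m′ ∎
      where
      A = inv (y ∷ u)
      B = inv (y′ ∷ v)
      C = inv ((y ∷ u) Vec.++ (y′ ∷ v))
      Q = F r u * F s v
      N₀ = sum r ℕ.+ sum s
      κ′ : Word (suc k) (suc ℓ) (suc n) → Vec ℕ (suc n) → ℕ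
      κ′ w t = weight w (suc x ∷ r) (suc z ∷ s) t
      m′ : Word (suc k) (suc ℓ) (suc n) → Vec U (suc n)
      m′ w = merge w (y ∷ u) (y′ ∷ v)
      Nˡ : suc x ℕ.+ suc z ℕ.+ N₀ ≡ N
      Nˡ = ≡.trans (+ℕ.interchange (suc x) (suc z) (sum r) (sum s)) N≡

open ≡ using (refl; cong; cong₂)

-- The identities for fractions in ℤ(U)

module RationalFunctions {a} (U : Set a) where

  fractions : CommutativeSemiring a a
  fractions = CommutativeRing.commutativeSemiring (fracRing U)

  private
    module ≃ = CommutativeSemiring fractions
    module ≋ = CommutativeRing (polyRing U)
  open SemiringSolver ≋.commutativeSemiring

  fromℕ-embedding : ℕEmbedding fractions
  fromℕ-embedding = record
    { ι = fromℕ ; ι-0 = ≋-refl ; ι-1 = ≋-refl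
    ; ι-+ = λ m n → ≋-trans (⊗-cong (con-⊕ (+ m) (+ n)) ≋-refl)
        (solve 2 (λ x y → (x :+ y) :* (con 1 :* con 1)
                       := (x :* con 1 :+ y :* con 1) :* con 1) ≋-refl _ _)
    ; ι-* = λ m n → ≋-trans
        (⊗-cong (≋-trans (≡⇒≋ (cong con (ℤ.pos-* m n))) (con-⊗ (+ m) (+ n))) ≋-refl)
        (solve 2 (λ x y → (x :* y) :* (con 1 :* con 1) := (x :* y) :* con 1) ≋-refl _ _) }

  -- `≃` sees only numerators and denominators, so any proofs of nonvanishing will do, in particular
  -- those built into `f`.
  1/-* : ∀ {p q : Poly U} p≉0 q≉0 pq≉0 → 1/ (p ⊗ q) pq≉0 ≃ 1/ p p≉0 *ᶠ 1/ q q≉0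
  1/-* {p} {q} _ _ _ = solve 2 (λ p q → con 1 :* (p :* q) := (con 1 :* con 1) :* (p :* q))
    ≋-refl p q

  -- linear [] = 0 has no inverse; the value at [] is arbitrary.
  inverse : ∀ {n} → Vec U n → Frac U
  inverse [] = 1ᶠ
  inverse (u ∷ us) = 1/ (linear (u ∷ us)) (linear-nonzero (u ∷ us))

  inverse-cong : ∀ {m n} (us : Vec U m) (vs : Vec U n) → linear us ≋ linear vs →
                 inverse us ≃ inverse vs
  inverse-cong [] [] e = ≋-refl
  inverse-cong [] (v ∷ vs) e = contradiction (≋-sym e) (linear-nonzero (v ∷ vs))
  inverse-cong (u ∷ us) [] e = contradiction e (linear-nonzero (u ∷ us))
  inverse-cong (u ∷ us) (v ∷ vs) e = ⊗-cong ≋-refl (≋-sym e)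

  linear-++ : ∀ {m n} (us : Vec U m) (vs : Vec U n) →
              linear (us Vec.++ vs) ≋ linear us ⊕ linear vs
  linear-++ [] vs = ≋-sym (⊕-identityˡ _)
  linear-++ (u ∷ us) vs =
    ≋-trans (⊕-cong ≋-refl (linear-++ us vs)) (≋-sym (⊕-assoc _ _ _))

  linear-merge : ∀ {k ℓ n} (w : Word k ℓ n) (us : Vec U k) (vs : Vec U ℓ) →
                 linear (merge w us vs) ≋ linear us ⊕ linear vs
  linear-merge [] [] [] = ≋-sym (⊕-identityˡ _)
  linear-merge (l∷ w) (u ∷ us) vs =
    ≋-trans (⊕-cong ≋-refl (linear-merge w us vs)) (≋-sym (⊕-assoc _ _ _))
  linear-merge (r∷ w) us (v ∷ vs) = ≋-trans (⊕-cong ≋-refl (linear-merge w us vs))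
    (solve 3 (λ x y z → y :+ (x :+ z) := x :+ (y :+ z)) ≋-refl _ _ _)

  inverse-* : ∀ {m n} u (us : Vec U m) v (vs : Vec U n) →
              inverse (u ∷ us) *ᶠ inverse (v ∷ vs)
                ≃ inverse ((u ∷ us) Vec.++ (v ∷ vs)) *ᶠ (inverse (u ∷ us) +ᶠ inverse (v ∷ vs))
  inverse-* u us v vs = ≋-trans (⊗-cong ≋-refl (⊗-cong (linear-++ (u ∷ us) (v ∷ vs)) ≋-refl))
    (solve 2 (λ p q → (con 1 :* con 1) :* ((p :+ q) :* (p :* q))
                   := (con 1 :* (con 1 :* q :+ con 1 :* p)) :* (p :* q))
      ≋-refl (linear (u ∷ us)) (linear (v ∷ vs)))

  open Exp ≃.semiring using (_^_)

  1/-^ : ∀ {p : Poly U} (p≉0 : ¬ p ≋ 0ₚ) s → 1/ (p ^ₚ s) (^-nonzero p≉0 s) ≃ 1/ p p≉0 ^ s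
  1/-^ p≉0 zero = ≋-refl
  1/-^ {p} p≉0 (suc s) = ≃.trans {1/ (p ^ₚ suc s) (^-nonzero p≉0 (suc s))}
    {1/ p p≉0 *ᶠ 1/ (p ^ₚ s) (^-nonzero p≉0 s)} {1/ p p≉0 ^ suc s}
    (1/-* p≉0 (^-nonzero p≉0 s) (^-nonzero p≉0 (suc s)))
    (≃.*-congˡ {1/ p p≉0} {1/ (p ^ₚ s) (^-nonzero p≉0 s)} {1/ p p≉0 ^ s} (1/-^ p≉0 s))

  f-∷ : ∀ {n} s (ss : Vec ℕ n) u us →
        f (s ∷ ss) (u ∷ us) ≃ inverse (u ∷ us) ^ s *ᶠ f ss us
  f-∷ s ss u us = ≃.trans {f (s ∷ ss) (u ∷ us)}
    {1/ (p ^ₚ s) (^-nonzero p≉0 s) *ᶠ f ss us} {inverse (u ∷ us) ^ s *ᶠ f ss us}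
    (1/-* (^-nonzero p≉0 s) (denominator-nonzero ss us)
      (denominator-nonzero (s ∷ ss) (u ∷ us)))
    (≃.*-congʳ {f ss us} {1/ (p ^ₚ s) (^-nonzero p≉0 s)} {inverse (u ∷ us) ^ s} (1/-^ p≉0 s))
    where
    p = linear (u ∷ us)
    p≉0 = linear-nonzero (u ∷ us)

  open ShuffleExpansion fractions fromℕ-embedding inverse f public
  open Expand ≋-refl f-∷ inverse-*
    (λ w us vs → inverse-cong (merge w us vs) (us Vec.++ vs)
      (≋-trans (linear-merge w us vs) (≋-sym (linear-++ us vs))))
    (λ us → inverse-cong (us Vec.++ []) us
      (≋-trans (linear-++ us []) (≋-trans (⊕-comm _ _) (⊕-identityˡ _))))
    public

open import Data.Nat using (_+_)

theorem3p2 : ∀ {a} (U : Set a) (k ℓ : ℕ) → 1 ≤ k → 1 ≤ ℓ →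
    (r : Vec ℕ k) (s : Vec ℕ ℓ) → All (1 ≤_) r → All (1 ≤_) s →
    (u : Vec U k) (v : Vec U ℓ) →
    f r u *ᶠ f s v
    ≃ ∑[ σ ∈ shuffles k ℓ ] ∑[ t ∈ compositions (k + ℓ) (sum r + sum s) ]
    (fromℕ (coeffProduct σ r s t) *ᶠ f t (u ш[ σ ] v))
theorem3p2 U k ℓ 1≤k 1≤ℓ r s r⁺ s⁺ u v = begin
  f r u *ᶠ f s v
    -- With the bound `M` equal to the total `N`, `boundedCompositions` is `compositions`.
    ≈⟨ expand k ℓ (k + ℓ) refl N r s r⁺ s⁺ u v refl ℕ.≤-refl ⟩
  ∑ (words k ℓ (k + ℓ)) G
    ≈⟨ ∑-↭ G (wordOf-shuffles {k} {ℓ}) ⟨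
  ∑ (List.map wordOf (shuffles k ℓ)) G
    ≈⟨ ∑-map wordOf (shuffles k ℓ) G ⟩
  ∑ (shuffles k ℓ) (λ σ → G (wordOf σ))
    -- The coefficients are compared for positive t, so membership in `compositions` has to be at
    -- hand.
    ≈⟨ ∑-cong (shuffles k ℓ) {λ σ → G (wordOf σ)} {H} (λ σ →
         ∑-cong-∈ (compositions (k + ℓ) N) {g (wordOf σ)} {h σ} λ {t} t∈ →
           ≃.sym {h σ t} {g (wordOf σ) t} (≃.reflexive (h≡g σ t∈))) ⟩
  ∑ (shuffles k ℓ) H ∎
  where
  open RationalFunctions U
  module ≃ = CommutativeSemiring fractions
  open FiniteSum fractions
  open SetoidReasoning ≃.setoid
  N = sum r + sum s
  g : Word k ℓ (k + ℓ) → Vec ℕ (k + ℓ) → Frac U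
  g w t = fromℕ (weight w r s t) *ᶠ f t (merge w u v)
  h : Shuffle k ℓ → Vec ℕ (k + ℓ) → Frac U
  h σ t = fromℕ (coeffProduct σ r s t) *ᶠ f t (u ш[ σ ] v)
  G : Word k ℓ (k + ℓ) → Frac U
  G w = ∑ (compositions (k + ℓ) N) (g w)
  H : Shuffle k ℓ → Frac U
  H σ = ∑ (compositions (k + ℓ) N) (h σ)
  h≡g : ∀ σ {t} → t ∈ compositions (k + ℓ) N → h σ t ≡ g (wordOf σ) t
  h≡g σ {t} t∈ = cong₂ (λ c us → fromℕ c *ᶠ f t us)
    (coeffProduct≡weight σ (wordOf σ) (φ≗posˡ σ) (ψ≗posʳ σ) r s 1≤k 1≤ℓ
      (positive-tuples (k + ℓ)
        (proj₁ (∈-filter⁻ (λ t → sum t ℕ.≟ N) {xs = tuples (range N) (k + ℓ)} t∈))))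
    (ш≡merge σ (wordOf σ) (φ≗posˡ σ) (ψ≗posʳ σ) u v)
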